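{- Let $F=\{f_1=b_1,\dots,f_m=b_m\}$ be an unsatisfiable width-$d$ system of linear equations over $\mathbb{F}_q$. There is a Stabbing Planes refutation of (the CNF encoding of) $F$ of size $(mqd)^{O(\log m)}q^d=|F|^{O(\log m)}$.
   Context: Width $d$ means each equation $f_i=a_iz$ (with $a_i\in\mathbb{F}_q^n$, $b_i\in\mathbb{F}_q$) has at most $d$ variables with nonzero coefficient. In the CNF encoding each $\mathbb{F}_q$-valued variable is encoded by Boolean variables and each equation by $q^{d-1}$ width-$d$ clauses, one ruling out each falsifying assignment; $|F|:=mq^{d-1}$. The CNF is translated into linear inequalities in the standard way. Stabbing Planes: a refutation is a binary tree; each internal node is labelled by a query $(ax\le b-1,ax\ge b)$ with integer $a,b$ whose outgoing edges carry these two inequalities; each leaf is labelled by a nonnegative linear combination of the input inequalities and those on its root path yielding $0\ge1$; size = number of queries. -}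

module Defs where

open import Data.Nat as ℕ using (ℕ; zero; suc)
open import Data.Integer as ℤ using (ℤ; +_)
open import Data.Fin using (Fin; _≟_)
open import Data.Bool using (Bool; true; false)
open import Data.List using (List; []; _∷_; filter; length; allFin; foldr)
open import Data.List.Membership.Propositional using (_∈_)
open import Data.Product using (Σ; _×_; _,_; ∃; proj₁; proj₂)
open import Data.Sum using (_⊎_)
open import Relation.Nullary using (¬_)
open import Relation.Nullary.Decidable using (¬?)
open import Relation.Binary.PropositionalEquality using (_≡_; _≢_)
open import Algebra.Core using (Op₁; Op₂)
open import Algebra.Structures using (IsCommutativeRing)

-- Finite fields F_q.  Every finite field of order q is isomorphic to one
-- whose carrier is Fin q with propositional equality, so we quantify over
-- all field structures on Fin q.

record FiniteField (q : ℕ) : Set where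
  field
    _+_ _*_ : Op₂ (Fin q)
    -_      : Op₁ (Fin q)
    0# 1#   : Fin q
    isCommutativeRing : IsCommutativeRing _≡_ _+_ _*_ -_ 0# 1#
    0≢1     : 0# ≢ 1#
    _⁻¹     : Fin q → Fin q
    inverseˡ : ∀ x → x ≢ 0# → (x ⁻¹) * x ≡ 1#

record Equation (q n : ℕ) : Set where
  constructor _==_
  field
    coeffs : Fin n → Fin q
    rhs    : Fin q

open Equation public

module _ {q : ℕ} (𝔽 : FiniteField q) where
  open FiniteField 𝔽

  dot : ∀ {n} → (Fin n → Fin q) → (Fin n → Fin q) → Fin q
  dot {n} a z = foldr (λ j acc → (a j * z j) + acc) 0# (allFin n)

  Sat : ∀ {n} → (Fin n → Fin q) → Equation q n → Set
  Sat z e = dot (coeffs e) z ≡ rhs e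

  support : ∀ {n} → (Fin n → Fin q) → List (Fin n)
  support {n} a = filter (λ j → ¬? (a j ≟ 0#)) (allFin n)

  Width≤ : ∀ {n m} → ℕ → (Fin m → Equation q n) → Set
  Width≤ d F = ∀ i → length (support (coeffs (F i))) ℕ.≤ d

  Unsatisfiable : ∀ {n m} → (Fin m → Equation q n) → Set
  Unsatisfiable {n} F = ¬ (Σ (Fin n → Fin q) λ z → ∀ i → Sat z (F i))

  -- CNF encoding.  Boolean variable x_(j,α) means "z_j = α".

  BVar : ℕ → Set
  BVar n = Fin n × Fin q

  -- a literal: (variable, polarity); polarity true = positive
  Literal : ℕ → Set
  Literal n = BVar n × Bool

  Clause : ℕ → Set
  Clause n = List (Literal n)

  data CNF {n m : ℕ} (F : Fin m → Equation q n) : Clause n → Set where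
    atLeastOne : ∀ j → CNF F (foldr (λ α c → ((j , α) , true) ∷ c) [] (allFin q))
    atMostOne  : ∀ j α β → α ≢ β → CNF F (((j , α) , false) ∷ ((j , β) , false) ∷ [])
    -- for each equation i and each assignment σ to the variables of its
    -- support falsifying it, the width-|supp| clause ∨_{j∈supp} ¬x_(j,σ j)
    -- (an assignment to the support is given by any total σ; the clause only
    -- depends on σ restricted to the support)
    equation   : ∀ i (σ : Fin n → Fin q) → ¬ Sat σ (F i) →
                 CNF F (foldr (λ j c → ((j , σ j) , false) ∷ c) [] (support (coeffs (F i))))

  -- Linear inequalities  a·x ≥ b  over the Boolean variables.

  Ineq : ℕ → Set
  Ineq n = (BVar n → ℤ) × ℤ

  unit : ∀ {n} → BVar n → BVar n → ℤ
  unit {n} (j , α) (k , β) with j ≟ k | α ≟ β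
  ... | Relation.Nullary.yes _ | Relation.Nullary.yes _ = + 1
  ... | _ | _ = + 0

  zeroV : ∀ {n} → BVar n → ℤ
  zeroV _ = + 0

  -- standard translation of a clause  ∨ ℓ  into  Σ ℓ ≥ 1, where
  -- the literal x contributes x and ¬x contributes 1 - x.
  clauseIneq : ∀ {n} → Clause n → Ineq n
  clauseIneq [] = zeroV , + 1
  clauseIneq ((v , true) ∷ c) =
    (λ w → unit v w ℤ.+ proj₁ (clauseIneq c) w) , proj₂ (clauseIneq c)
  clauseIneq ((v , false) ∷ c) =
    (λ w → (ℤ.- unit v w) ℤ.+ proj₁ (clauseIneq c) w) , proj₂ (clauseIneq c) ℤ.- + 1

  data Input {n m : ℕ} (F : Fin m → Equation q n) : Ineq n → Set where
    clause : ∀ c → CNF F c → Input F (clauseIneq c)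
    lower  : ∀ v → Input F (unit v , + 0)
    upper  : ∀ v → Input F ((λ w → ℤ.- unit v w) , ℤ.- (+ 1))

-- A tree; a node carries the query (a·x ≤ b-1 , a·x ≥ b).
data SPTree (V : Set) : Set where
  leaf : SPTree V
  node : (a : V → ℤ) (b : ℤ) → SPTree V → SPTree V → SPTree V

size : ∀ {V} → SPTree V → ℕ
size leaf = 0
size (node _ _ l r) = suc (size l ℕ.+ size r)

module _ {V : Set} (Input : (V → ℤ) × ℤ → Set) where

  IneqV : Set
  IneqV = (V → ℤ) × ℤ

  Avail : List IneqV → IneqV → Set
  Avail path I = Input I ⊎ I ∈ path

  Combination : List IneqV → Set
  Combination path = List (ℕ × Σ IneqV (Avail path))

  combLHS : ∀ {path} → Combination path → V → ℤ
  combLHS [] v = + 0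
  combLHS ((k , (a , _) , _) ∷ cs) v = (+ k) ℤ.* a v ℤ.+ combLHS cs v

  combRHS : ∀ {path} → Combination path → ℤ
  combRHS [] = + 0
  combRHS ((k , (_ , b) , _) ∷ cs) = (+ k) ℤ.* b ℤ.+ combRHS cs

  -- The combination (1/D)·Σ λ_k (a_k x ≥ b_k), D ≥ 1, i.e. an arbitrary
  -- nonnegative rational combination written over a common denominator D,
  -- is the inequality  0 ≥ 1.
  YieldsContradiction : ∀ {path} → Combination path → Set
  YieldsContradiction cs =
    Σ ℕ λ D → (1 ℕ.≤ D) × ((∀ v → combLHS cs v ≡ + 0) × (combRHS cs ≡ + D))

  Refutes : List IneqV → SPTree V → Set
  Refutes path leaf = Σ (Combination path) YieldsContradiction
  Refutes path (node a b l r) =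
    Refutes (((λ v → ℤ.- a v) , ℤ.- (b ℤ.- + 1)) ∷ path) l
    × Refutes ((a , b) ∷ path) r

  SPRefutation : SPTree V → Set
  SPRefutation T = Refutes [] T

{-# OPTIONS --safe #-}

-- F_q^m is a vector space over the prime field F_p, so if b lies outside the image of
-- z ↦ (a_i z)_i there is an F_p-linear φ : F_q^m → F_p with φ(image) = 0 and φ(b) ≠ 0.
-- Writing φ as the sum of its restrictions φ_i to the coordinates, the row i asserts the
-- value φ_i(b_i) for the additive function z ↦ φ_i(a_i z), which on the Boolean variables
-- x_(j,α) is the integer form with coefficients φ_i(a_ij α) ∈ {0,…,p-1}, taken mod p.
-- All rows together sum to 0 mod p although their targets do not.  Branching on the integer
-- value of half of the rows keeps one half whose value contradicts its target mod p, so after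
-- log m rounds a single row is left; it is refuted by trying all q^d values of its variables.
-- Only one F_p-valued form is tracked even when q is a proper power of p: fixing all F_p
-- coordinates of an F_q-valued form would cost a factor exponential in log q per round.

module Submission where

open import Defs
open import Algebra.Bundles using (CommutativeMonoid; CommutativeRing)
import Algebra.Construct.Pointwise as Pointwise
open import Data.Bool using (true; false; if_then_else_)
open import Data.Fin using (Fin; _≟_; toℕ; fromℕ<; finToFun; funToFin)
open import Data.Fin.Properties
  using (any?; all?; toℕ-fromℕ<; toℕ≤pred[n]; pigeonhole; finToFun-funToFin)
open import Data.Integer as ℤ using (ℤ; +_)
import Data.Integer.Divisibility.Signed as ∣ℤ
import Data.Integer.Properties as ℤₚ
open import Data.Integer.Tactic.RingSolver using (solve-∀)
open import Data.List
  using (List; []; _∷_; _++_; foldr; allFin; filter; length; take; drop; cartesianProductWith)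
open import Data.List.Membership.Propositional using (_∈_; _∉_)
open import Data.List.Membership.Propositional.Properties
  using (∈-allFin; ∈-filter⁺; ∈-cartesianProductWith⁺)
open import Data.List.Properties using (length-tabulate; length-take; length-drop; take++drop≡id)
open import Data.List.Relation.Binary.Subset.Propositional using (_⊆_)
open import Data.List.Relation.Unary.All as All using (All; []; _∷_)
open import Data.List.Relation.Unary.AllPairs using (_∷_)
open import Data.List.Relation.Unary.Any using (here; there)
open import Data.List.Relation.Unary.Unique.Propositional using (Unique)
open import Data.List.Relation.Unary.Unique.Propositional.Properties using (allFin⁺)
open import Data.Nat as ℕ using (ℕ; zero; suc; _+_; _*_; _^_; _≤_; z≤n; s≤s; NonZero)
open import Data.Nat.Coprimality using (Coprime; coprime-Bézout)
open import Data.Nat.Divisibility as ∣ using (_∣_; _∣?_; divides)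
open import Data.Nat.DivMod using (_%_; _/_; m≡m%n+[m/n]*n; m%n<n; m<n⇒m%n≡m)
open import Data.Nat.GCD using (module Bézout)
open import Data.Nat.Induction using (<-wellFounded)
open import Data.Nat.ListAction using (product)
open import Data.Nat.Logarithm using (⌈log₂_⌉)
open import Data.Nat.Logarithm.Core using (⌈log2⌉)
open import Data.Nat.Primality using (Prime; prime⇒nonZero; prime⇒irreducible; ¬prime[1])
open import Data.Nat.Primality.Factorisation using (factorise; PrimeFactorisation)
import Data.Nat.Properties as ℕₚ
import Data.Nat.Tactic.RingSolver as ℕSolver
open import Data.Product using (Σ; _×_; _,_; ∃; proj₁; proj₂)
open import Data.Sum using (_⊎_; inj₁; inj₂; map)
open import Function using (_∘_; id)
open import Induction.WellFounded using (Acc; acc)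
open import Level using (0ℓ)
open import Relation.Binary.Definitions using (tri<; tri≈; tri>)
open import Relation.Binary.PropositionalEquality
  using (_≡_; _≢_; refl; sym; trans; cong; cong₂; subst; module ≡-Reasoning)
open import Relation.Nullary using (¬_; Dec; yes; no; does; contradiction)
open import Relation.Nullary.Decidable using (¬?; map′; dec-true; dec-false; decidable-stable)
open import Relation.Unary using (Decidable)

-- Finite sums in commutative monoids.

module SumOver {c ℓ} (M : CommutativeMonoid c ℓ) where
  open CommutativeMonoid M renaming (refl to ≈-refl; sym to ≈-sym; trans to ≈-trans)
  open import Algebra.Properties.CommutativeSemigroup commutativeSemigroup using (interchange)

  -- The same fold as in `dot`, so over the additive monoid of the field the lemmas on `sumOver`
  -- apply to `dot` by unfolding.
  sumOver : {A : Set} → List A → (A → Carrier) → Carrier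
  sumOver xs f = foldr (λ x acc → f x ∙ acc) ε xs

  sumOver-cong : {A : Set} (xs : List A) {f g : A → Carrier} →
                 (∀ x → f x ≈ g x) → sumOver xs f ≈ sumOver xs g
  sumOver-cong []       eq = ≈-refl
  sumOver-cong (x ∷ xs) eq = ∙-cong (eq x) (sumOver-cong xs eq)

  sumOver-ε : {A : Set} (xs : List A) {f : A → Carrier} →
              (∀ {x} → x ∈ xs → f x ≈ ε) → sumOver xs f ≈ ε
  sumOver-ε []       eq = ≈-refl
  sumOver-ε (x ∷ xs) eq =
    ≈-trans (∙-cong (eq (here refl)) (sumOver-ε xs (λ x∈xs → eq (there x∈xs)))) (identityˡ ε)

  sumOver-single : {A : Set} {xs : List A} {f : A → Carrier} {k : A} → Unique xs → k ∈ xs →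
                   (∀ x → x ≢ k → f x ≈ ε) → sumOver xs f ≈ f k
  sumOver-single {f = f} (k∉xs ∷ _) (here refl) eq =
    ≈-trans (∙-congˡ (sumOver-ε _ (λ {x} x∈xs → eq x (λ x≡k → All.lookup k∉xs x∈xs (sym x≡k)))))
            (identityʳ _)
  sumOver-single (x∉xs ∷ u) (there k∈xs) eq =
    ≈-trans (∙-cong (eq _ (All.lookup x∉xs k∈xs)) (sumOver-single u k∈xs eq)) (identityˡ _)

  sumOver-∙ : {A : Set} (xs : List A) (f g : A → Carrier) →
              sumOver xs (λ x → f x ∙ g x) ≈ sumOver xs f ∙ sumOver xs g
  sumOver-∙ []       f g = ≈-sym (identityˡ ε)
  sumOver-∙ (x ∷ xs) f g =
    ≈-trans (∙-congˡ (sumOver-∙ xs f g)) (interchange _ _ _ _)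

  sumOver-++ : {A : Set} (xs ys : List A) (f : A → Carrier) →
               sumOver (xs ++ ys) f ≈ sumOver xs f ∙ sumOver ys f
  sumOver-++ []       ys f = ≈-sym (identityˡ _)
  sumOver-++ (x ∷ xs) ys f = ≈-trans (∙-congˡ (sumOver-++ xs ys f)) (≈-sym (assoc _ _ _))

open SumOver ℕₚ.+-0-commutativeMonoid
  renaming (sumOver to sumℕ; sumOver-cong to sumℕ-cong; sumOver-ε to sumℕ-zero;
            sumOver-single to sumℕ-single; sumOver-++ to sumℕ-++)
  hiding (sumOver-∙)

-- Stabbing Planes derivations and query trees.

module Derivation {V : Set} (Input : (V → ℤ) × ℤ → Set) where

  Path : Set
  Path = List (IneqV Input)

  infix 3 _⊢_≥_
  -- A compositional stand-in for `Combination`: derivations nest, survive longer paths, and by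
  -- `conv` may be rewritten pointwise and weakened on the right.
  data _⊢_≥_ (path : Path) : (V → ℤ) → ℤ → Set where
    input : ∀ {a b} → Input (a , b) → path ⊢ a ≥ b
    hyp   : ∀ {a b} → (a , b) ∈ path → path ⊢ a ≥ b
    triv  : path ⊢ (λ _ → + 0) ≥ + 0
    add   : ∀ {a b a′ b′} → path ⊢ a ≥ b → path ⊢ a′ ≥ b′ →
            path ⊢ (λ v → a v ℤ.+ a′ v) ≥ b ℤ.+ b′
    scale : ∀ {a b} (k : ℕ) → path ⊢ a ≥ b → path ⊢ (λ v → + k ℤ.* a v) ≥ + k ℤ.* b
    conv  : ∀ {a a′ b b′} → (∀ v → a v ≡ a′ v) → b′ ℤ.≤ b → path ⊢ a ≥ b → path ⊢ a′ ≥ b′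

  weaken : ∀ {path path′ a b} → path ⊆ path′ → path ⊢ a ≥ b → path′ ⊢ a ≥ b
  weaken sub (input i)       = input i
  weaken sub (hyp h)         = hyp (sub h)
  weaken sub triv            = triv
  weaken sub (add d e)       = add (weaken sub d) (weaken sub e)
  weaken sub (scale k d)     = scale k (weaken sub d)
  weaken sub (conv eq le d)  = conv eq le (weaken sub d)

  private
    module _ {path : Path} where

      scaleC : ℕ → Combination Input path → Combination Input path
      scaleC k []             = []
      scaleC k ((l , i) ∷ cs) = (k ℕ.* l , i) ∷ scaleC k cs

      lhs-++ : ∀ (cs ds : Combination Input path) v →
               combLHS Input (cs ++ ds) v ≡ combLHS Input cs v ℤ.+ combLHS Input ds v
      lhs-++ []       ds v = sym (ℤₚ.+-identityˡ _)
      lhs-++ ((l , (a , _) , _) ∷ cs) ds v =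
        trans (cong (λ z → + l ℤ.* a v ℤ.+ z) (lhs-++ cs ds v))
              (sym (ℤₚ.+-assoc (+ l ℤ.* a v) (combLHS Input cs v) (combLHS Input ds v)))

      rhs-++ : ∀ (cs ds : Combination Input path) →
               combRHS Input (cs ++ ds) ≡ combRHS Input cs ℤ.+ combRHS Input ds
      rhs-++ []       ds = sym (ℤₚ.+-identityˡ _)
      rhs-++ ((l , (_ , b) , _) ∷ cs) ds =
        trans (cong (λ z → + l ℤ.* b ℤ.+ z) (rhs-++ cs ds))
              (sym (ℤₚ.+-assoc (+ l ℤ.* b) (combRHS Input cs) (combRHS Input ds)))

      distr : ∀ k l x y → + (k ℕ.* l) ℤ.* x ℤ.+ (+ k) ℤ.* y ≡ (+ k) ℤ.* ((+ l) ℤ.* x ℤ.+ y)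
      distr k l x y =
        trans (cong (λ z → z ℤ.* x ℤ.+ + k ℤ.* y) (ℤₚ.pos-* k l)) (lemma (+ k) (+ l) x y)
        where
        lemma : ∀ k l x y → k ℤ.* l ℤ.* x ℤ.+ k ℤ.* y ≡ k ℤ.* (l ℤ.* x ℤ.+ y)
        lemma = solve-∀

      lhs-scale : ∀ k (cs : Combination Input path) v →
                  combLHS Input (scaleC k cs) v ≡ + k ℤ.* combLHS Input cs v
      lhs-scale k []       v = sym (ℤₚ.*-zeroʳ (+ k))
      lhs-scale k ((l , (a , _) , _) ∷ cs) v =
        trans (cong (λ z → + (k ℕ.* l) ℤ.* a v ℤ.+ z) (lhs-scale k cs v)) (distr k l (a v) (combLHS Input cs v))

      rhs-scale : ∀ k (cs : Combination Input path) →
                  combRHS Input (scaleC k cs) ≡ + k ℤ.* combRHS Input cs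
      rhs-scale k []       = sym (ℤₚ.*-zeroʳ (+ k))
      rhs-scale k ((l , (_ , b) , _) ∷ cs) =
        trans (cong (λ z → + (k ℕ.* l) ℤ.* b ℤ.+ z) (rhs-scale k cs)) (distr k l b (combRHS Input cs))

      single : ∀ {a b} → Avail Input path (a , b) → Σ (Combination Input path) λ cs →
               (∀ v → combLHS Input cs v ≡ a v) × b ℤ.≤ combRHS Input cs
      single {a} {b} i = (1 , _ , i) ∷ [] ,
        (λ v → trans (ℤₚ.+-identityʳ _) (ℤₚ.*-identityˡ (a v))) ,
        ℤₚ.≤-reflexive (sym (trans (ℤₚ.+-identityʳ _) (ℤₚ.*-identityˡ b)))

  -- `conv` may lower a right-hand side, whereas that of a combination is fixed by its terms; hence
  -- equality on the left but only `≤` on the right.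
  combination : ∀ {path a b} → path ⊢ a ≥ b → Σ (Combination Input path) λ cs →
                (∀ v → combLHS Input cs v ≡ a v) × b ℤ.≤ combRHS Input cs
  combination (input i) = single (inj₁ i)
  combination (hyp h)   = single (inj₂ h)
  combination triv      = [] , (λ _ → refl) , ℤₚ.≤-refl
  combination (add d e) with combination d | combination e
  ... | cs , l , r | cs′ , l′ , r′ = cs ++ cs′ ,
    (λ v → trans (lhs-++ cs cs′ v) (cong₂ ℤ._+_ (l v) (l′ v))) ,
    ℤₚ.≤-trans (ℤₚ.+-mono-≤ r r′) (ℤₚ.≤-reflexive (sym (rhs-++ cs cs′)))
  combination (scale k d) with combination d
  ... | cs , l , r = scaleC k cs ,
    (λ v → trans (lhs-scale k cs v) (cong (+ k ℤ.*_) (l v))) ,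
    ℤₚ.≤-trans (ℤₚ.*-monoˡ-≤-nonNeg (+ k) r) (ℤₚ.≤-reflexive (sym (rhs-scale k cs)))
  combination (conv eq le d) with combination d
  ... | cs , l , r = cs , (λ v → trans (l v) (eq v)) , ℤₚ.≤-trans le r

  Absurd : Path → Set
  Absurd path = path ⊢ (λ _ → + 0) ≥ + 1

  -- The combination may yield `0 ≥ suc n` rather than `0 ≥ 1`; taking `suc n` as the common
  -- denominator normalises it.
  absurd⇒leaf : ∀ {path} → Absurd path → Refutes Input path leaf
  absurd⇒leaf d with combination d
  ... | cs , l , r with combRHS Input cs in eq
  ...   | + suc n = cs , suc n , s≤s z≤n , l , eq
  absurd⇒leaf d | cs , l , ℤ.+≤+ () | + zero

  -- s bounds the number of leaves, which is one more than the number of queries.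
  Refutable : Path → ℕ → Set
  Refutable path s = Σ (SPTree V) λ T → Refutes Input path T × suc (size T) ≤ s

  refutable-leaf : ∀ {path} → Absurd path → Refutable path 1
  refutable-leaf d = leaf , absurd⇒leaf d , ℕₚ.≤-refl

  refutable-mono : ∀ {path s t} → s ≤ t → Refutable path s → Refutable path t
  refutable-mono le (T , r , z) = T , r , ℕₚ.≤-trans z le

  query : ∀ {path s t} a b → Refutable (((λ v → ℤ.- a v) , ℤ.- (b ℤ.- + 1)) ∷ path) s →
          Refutable ((a , b) ∷ path) t → Refutable path (s + t)
  query a b (T , r , z) (T′ , r′ , z′) = node a b T T′ , (r , r′) ,
    ℕₚ.≤-trans (ℕₚ.≤-reflexive (cong suc (sym (ℕₚ.+-suc (size T) (size T′))))) (ℕₚ.+-mono-≤ z z′)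

  -- A chain of queries with thresholds `M, M - 1, …, 1`: the left branch lowers the upper bound by
  -- one, and the right branch meets the current upper bound, which pins `a` to a single integer.
  refutable-value : ∀ M s {path} (a : V → ℤ) →
    path ⊢ a ≥ + 0 → path ⊢ (λ v → ℤ.- a v) ≥ ℤ.- (+ M) →
    (∀ k {path′} → path ⊆ path′ → path′ ⊢ a ≥ + k → path′ ⊢ (λ v → ℤ.- a v) ≥ ℤ.- (+ k) →
      Refutable path′ s) →
    Refutable path (suc M * s)
  refutable-value zero    s a lo hi K =
    refutable-mono (ℕₚ.≤-reflexive (sym (ℕₚ.+-identityʳ s))) (K 0 (λ x → x) lo hi)
  refutable-value (suc M) s a lo hi K =
    refutable-mono (ℕₚ.≤-reflexive (ℕₚ.+-comm (suc M * s) s))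
      (query a (+ suc M)
        (refutable-value M s a (weaken there lo) (hyp (here refl)) (λ k sub → K k (λ x → sub (there x))))
        (K (suc M) there (hyp (here refl)) (weaken there hi)))

  -- The sign s lets one statement serve lower (s = 1) and upper (s = -1) bounds.
  sum-⊢ : ∀ {path} {A : Set} (s : ℤ) (xs : List A) (f : A → V → ℕ) (g : A → ℕ) →
          (∀ x → path ⊢ (λ v → s ℤ.* + f x v) ≥ s ℤ.* + g x) →
          path ⊢ (λ v → s ℤ.* + sumℕ xs (λ x → f x v)) ≥ s ℤ.* + sumℕ xs g
  sum-⊢ s []       f g ds = conv (λ _ → sym (ℤₚ.*-zeroʳ s)) (ℤₚ.≤-reflexive (ℤₚ.*-zeroʳ s)) triv
  sum-⊢ s (x ∷ xs) f g ds =
    conv (λ v → split (f x v) _) (ℤₚ.≤-reflexive (sym (split (g x) _))) (add (ds x) (sum-⊢ s xs f g ds))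
    where
    split : ∀ m n → s ℤ.* + m ℤ.+ s ℤ.* + n ≡ s ℤ.* + (m + n)
    split m n = sym (ℤₚ.*-distribˡ-+ s (+ m) (+ n))

-- Arithmetic mod p and separating functionals.

inverse-mod-prime : ∀ {p} → Prime p → ∀ {k} → ¬ p ∣ k →
                    ∃ λ k′ → ∃ λ a → ∃ λ b → k′ * k + a * p ≡ 1 + b * p
inverse-mod-prime {p} pr {k} p∤k with coprime-Bézout coprime
  where
  coprime : Coprime p k
  coprime (d∣p , d∣k) with prime⇒irreducible pr d∣p
  ... | inj₁ d≡1 = d≡1
  ... | inj₂ refl = contradiction d∣k p∤k
... | Bézout.-+ x y eq = y , 0 , x , trans (ℕₚ.+-identityʳ (y * k)) (sym eq)
inverse-mod-prime {zero} pr p∤k | Bézout.+- x y eq with () ← prime⇒nonZero pr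
-- Here the inverse of `k` is `-y`; with `suc p` the prime, `p * y` represents it without
-- subtraction.
inverse-mod-prime {suc p} pr {k} p∤k | Bézout.+- x y eq =
  p * y , x , y * k , trans (cong (λ x → p * y * k + x) (sym eq)) (lemma p y k)
  where
  lemma : ∀ p y k → p * y * k + (1 + y * k) ≡ 1 + y * k * suc p
  lemma = ℕSolver.solve-∀

-- In a monoid of prime exponent, additive submonoids are F_p-subspaces.  A submonoid H that
-- is maximal among those avoiding v has H + ⟨v⟩ = everything, so the t with u + t v ∈ H is,
-- mod p, a linear functional of u that vanishes on H but not on v.
module PrimeExponent (M : CommutativeMonoid 0ℓ 0ℓ) {p : ℕ} (prime : Prime p) where
  open CommutativeMonoid M
    renaming (refl to ≈-refl; sym to ≈-sym; trans to ≈-trans)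
  open import Algebra.Properties.CommutativeMonoid.Mult M renaming (_×_ to _·_)
  open import Algebra.Properties.CommutativeSemigroup commutativeSemigroup
    using (interchange)
  open SumOver M
  open import Relation.Binary.Reasoning.Setoid setoid

  record Submonoid : Set₁ where
    field
      Mem  : Carrier → Set
      mem? : Decidable Mem
      resp : ∀ {x y} → x ≈ y → Mem x → Mem y
      ε∈   : Mem ε
      ∙∈   : ∀ {x y} → Mem x → Mem y → Mem (x ∙ y)

    ·∈ : ∀ n {x} → Mem x → Mem (n · x)
    ·∈ zero    x∈ = ε∈
    ·∈ (suc n) x∈ = ∙∈ x∈ (·∈ n x∈)

  open Submonoid

  _⊑_ : Submonoid → Submonoid → Set
  H ⊑ K = ∀ {x} → Mem H x → Mem K x

  module _ (exponent : ∀ x → p · x ≈ ε) where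

    private instance
      p≢0 : NonZero p
      p≢0 = prime⇒nonZero prime

    multiple-· : ∀ a x → (a * p) · x ≈ ε
    multiple-· a x = begin
      (a * p) · x ≡⟨ cong (_· x) (ℕₚ.*-comm a p) ⟩
      (p * a) · x ≈⟨ ×-assocˡ x p a ⟨
      p · (a · x) ≈⟨ exponent (a · x) ⟩
      ε           ∎

    +-multiple-· : ∀ n a x → (n + a * p) · x ≈ n · x
    +-multiple-· n a x = begin
      (n + a * p) · x       ≈⟨ ×-homo-+ x n (a * p) ⟩
      n · x ∙ (a * p) · x   ≈⟨ ∙-congˡ (multiple-· a x) ⟩
      n · x ∙ ε             ≈⟨ identityʳ _ ⟩
      n · x                 ∎

    %-· : ∀ n x → n · x ≈ (n % p) · x
    %-· n x = ≈-trans (reflexive (cong (_· x) (m≡m%n+[m/n]*n n p))) (+-multiple-· (n % p) (n / p) x)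

    divides-· : ∀ {n} → p ∣ n → ∀ x → n · x ≈ ε
    divides-· (divides a refl) x = multiple-· a x

    invert-· : ∀ {k} → ¬ p ∣ k → ∃ λ k′ → ∀ x → k′ · (k · x) ≈ x
    invert-· {k} p∤k with inverse-mod-prime prime p∤k
    ... | k′ , a , b , eq = k′ , λ x → begin
      k′ · (k · x)             ≈⟨ ×-assocˡ x k′ k ⟩
      (k′ * k) · x             ≈⟨ +-multiple-· (k′ * k) a x ⟨
      (k′ * k + a * p) · x     ≡⟨ cong (_· x) eq ⟩
      (1 + b * p) · x          ≈⟨ +-multiple-· 1 b x ⟩
      1 · x                    ≈⟨ ×-homo-1 x ⟩
      x                        ∎

    -- This is `H + ⟨u⟩`: exponent p makes every multiple of `u` invertible, so the multiple may
    -- stand on the side of `x`. Membership is decidable because only `k < p` has to be tried.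
    adjoin : Submonoid → Carrier → Submonoid
    adjoin H u = record
      { Mem  = λ x → ∃ λ k → Mem H (x ∙ k · u)
      ; mem? = λ x → map′ (λ (k , h) → toℕ k , h)
          (λ (k , h) → fromℕ< (m%n<n k p) ,
            resp H (∙-congˡ (≈-trans (%-· k u)
              (reflexive (cong (_· u) (sym (toℕ-fromℕ< (m%n<n k p))))))) h)
          (any? λ k → mem? H (x ∙ toℕ k · u))
      ; resp = λ x≈y (k , h) → k , resp H (∙-congʳ x≈y) h
      ; ε∈   = 0 , resp H (≈-sym (identityˡ ε)) (ε∈ H)
      ; ∙∈   = λ (k , h) (k′ , h′) → k + k′ , resp H (combine _ _ u k k′) (∙∈ H h h′)
      }
      where
      combine : ∀ x y u k k′ → (x ∙ k · u) ∙ (y ∙ k′ · u) ≈ (x ∙ y) ∙ (k + k′) · u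
      combine x y u k k′ = ≈-trans (interchange _ _ _ _) (∙-congˡ (≈-sym (×-homo-+ u k k′)))

    ⊑-adjoin : ∀ H u → H ⊑ adjoin H u
    ⊑-adjoin H u h = 0 , resp H (≈-sym (identityʳ _)) h

    ∈-adjoin : ∀ H u → Mem (adjoin H u) u
    -- The multiple is p - 1, since `u` plus p - 1 copies of `u` is `ε`.
    ∈-adjoin H u = ℕ.pred p , resp H (≈-trans (≈-sym (exponent u))
      (reflexive (cong (_· u) (sym (ℕₚ.suc-pred p))))) (ε∈ H)

    -- Steinitz exchange: in `v ∙ k · u ∈ H` the scalar `k` is nonzero mod p, as otherwise `v` would
    -- lie in `H`; multiplying by its inverse solves for `u`.
    exchange : ∀ H {u v} → ¬ Mem H v → Mem (adjoin H u) v → Mem (adjoin H v) u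
    exchange H {u} {v} v∉ (k , h) with p ∣? k
    ... | yes p∣k = contradiction (resp H (≈-trans (∙-congˡ (divides-· p∣k u)) (identityʳ v)) h) v∉
    ... | no  p∤k with invert-· p∤k
    ...   | k′ , inv = k′ , resp H eq (·∈ H k′ h)
      where
      eq : k′ · (v ∙ k · u) ≈ u ∙ k′ · v
      eq = begin
        k′ · (v ∙ k · u)         ≈⟨ ×-distrib-+ v (k · u) k′ ⟩
        k′ · v ∙ k′ · (k · u)    ≈⟨ ∙-congˡ (inv u) ⟩
        k′ · v ∙ u               ≈⟨ comm _ _ ⟩
        u ∙ k′ · v               ∎

    -- Greedy construction of a maximal submonoid avoiding `v`: each `u` is adjoined unless this
    -- would capture `v`, and in that case `exchange` already places `u` in `H + ⟨v⟩`.
    saturate : ∀ v (us : List Carrier) H → ¬ Mem H v →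
               Σ Submonoid λ K → H ⊑ K × ¬ Mem K v × (∀ {u} → u ∈ us → Mem (adjoin K v) u)
    saturate v []       H v∉ = H , (λ h → h) , v∉ , λ ()
    saturate v (u ∷ us) H v∉ with mem? (adjoin H u) v
    ... | yes v∈ with saturate v us H v∉
    ...   | K , H⊑K , v∉K , all = K , H⊑K , v∉K , λ where
            (here refl) → let (k , h) = exchange H v∉ v∈ in k , H⊑K h
            (there u∈)  → all u∈
    saturate v (u ∷ us) H v∉ | no v∉′ with saturate v us (adjoin H u) v∉′
    ...   | K , H⊑K , v∉K , all = K , (λ h → H⊑K (⊑-adjoin H u h)) , v∉K , λ where
            (here refl) → ⊑-adjoin K v (H⊑K (∈-adjoin H u))
            (there u∈)  → all u∈

    module Functional (H : Submonoid) (v : Carrier) (v∉ : ¬ Mem H v) where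

      -- The graph of a functional that is 0 on `H` and -1 at `v`. It is kept as a relation with
      -- natural-number values, which `value-unique` shows to be determined mod p.
      Value : Carrier → ℕ → Set
      Value u t = Mem H (u ∙ t · v)

      value-resp : ∀ {u u′} t → u ≈ u′ → Value u t → Value u′ t
      value-resp t eq = resp H (∙-congʳ eq)

      value-∈ : ∀ {u} → Mem H u → Value u 0
      value-∈ = resp H (≈-sym (identityʳ _))

      value-∙ : ∀ {u u′ t t′} → Value u t → Value u′ t′ → Value (u ∙ u′) (t + t′)
      value-∙ {t = t} {t′} h h′ =
        resp H (≈-trans (interchange _ _ _ _) (∙-congˡ (≈-sym (×-homo-+ v t t′)))) (∙∈ H h h′)

      value-sum : {A : Set} (xs : List A) {f : A → Carrier} {g : A → ℕ} →
                  (∀ x → Value (f x) (g x)) → Value (sumOver xs f) (sumℕ xs g)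
      value-sum []               hs = value-∈ (ε∈ H)
      value-sum (x ∷ xs) {g = g} hs = value-∙ {t = g x} {sumℕ xs g} (hs x) (value-sum xs hs)

      value-% : ∀ {u t} → Value u t → Value u (t % p)
      value-% {u} {t} = resp H (∙-congˡ (%-· t v))

      -- The number `pred p * t + t′` stands for `t′ - t`. Combining the two memberships with the
      -- same factors cancels `u` and leaves this multiple of `v` in `H`; were it invertible mod p,
      -- `v` itself would lie in `H`.
      value-unique : ∀ {u t t′} → Value u t → Value u t′ → p ∣ ℕ.pred p * t + t′
      value-unique {u} {t} {t′} h h′ with p ∣? (ℕ.pred p * t + t′)
      ... | yes d = d
      ... | no ¬d with invert-· ¬d
      ...   | k′ , inv = contradiction (resp H (≈-trans (×-congʳ k′ eq) (inv v))
                           (·∈ H k′ (∙∈ H (·∈ H (ℕ.pred p) h) h′))) v∉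
        where
        p-1 = ℕ.pred p
        eq : p-1 · (u ∙ t · v) ∙ (u ∙ t′ · v) ≈ (p-1 * t + t′) · v
        eq = begin
          p-1 · (u ∙ t · v) ∙ (u ∙ t′ · v)             ≈⟨ ∙-congʳ (×-distrib-+ u (t · v) p-1) ⟩
          (p-1 · u ∙ p-1 · (t · v)) ∙ (u ∙ t′ · v)     ≈⟨ interchange _ _ _ _ ⟩
          (p-1 · u ∙ u) ∙ (p-1 · (t · v) ∙ t′ · v)     ≈⟨ ∙-congʳ (comm _ _) ⟩
          (suc p-1 · u) ∙ (p-1 · (t · v) ∙ t′ · v)     ≡⟨ cong (λ n → n · u ∙ (p-1 · (t · v) ∙ t′ · v)) (ℕₚ.suc-pred p) ⟩
          (p · u) ∙ (p-1 · (t · v) ∙ t′ · v)           ≈⟨ ∙-congʳ (exponent u) ⟩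
          ε ∙ (p-1 · (t · v) ∙ t′ · v)                 ≈⟨ identityˡ _ ⟩
          p-1 · (t · v) ∙ t′ · v                       ≈⟨ ∙-congʳ (×-assocˡ v p-1 t) ⟩
          (p-1 * t) · v ∙ t′ · v                       ≈⟨ ×-homo-+ v (p-1 * t) t′ ⟨
          (p-1 * t + t′) · v                           ∎

-- The characteristic of a finite field.

module FieldFacts {q : ℕ} (𝔽 : FiniteField q) where
  open FiniteField 𝔽 using (0≢1; _⁻¹; inverseˡ)

  𝔽-ring : CommutativeRing 0ℓ 0ℓ
  𝔽-ring = record { isCommutativeRing = FiniteField.isCommutativeRing 𝔽 }

  open CommutativeRing 𝔽-ring
    using (semiring; ring; +-commutativeMonoid; 0#; 1#; +-identityʳ; *-identityˡ; *-assoc;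
           zeroˡ; zeroʳ; distribˡ; -‿inverseʳ)
    renaming (_+_ to _+ᶠ_; _*_ to _*ᶠ_; -_ to -ᶠ_)
  open import Algebra.Properties.Semiring.Mult semiring
    using (×-assoc-*; ×1-homo-*; ×-homo-+) renaming (_×_ to _·_)
  open import Algebra.Properties.Ring ring using (+-cancelˡ; -‿+-comm; -0#≈0#; -‿distribʳ-*; -‿involutive)
  open SumOver +-commutativeMonoid

  -- A factor `p` with `p · 1# ≢ 0#` is invertible in the field and can be cancelled, and an empty
  -- product would give `1# ≡ 0#`.
  prime-factor-annihilates : ∀ ps → All Prime ps → product ps · 1# ≡ 0# →
                             ∃ λ p → Prime p × p ∣ product ps × p · 1# ≡ 0#
  prime-factor-annihilates [] [] eq = contradiction (sym (trans (sym (+-identityʳ 1#)) eq)) 0≢1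
  prime-factor-annihilates (p ∷ ps) (pr ∷ prs) eq with p · 1# ≟ 0#
  ... | yes p·1≡0 = p , pr , ∣.m∣m*n (product ps) , p·1≡0
  ... | no  p·1≢0 with prime-factor-annihilates ps prs rest≡0
    where
    open ≡-Reasoning
    x = p · 1#
    y = product ps · 1#
    rest≡0 : y ≡ 0#
    rest≡0 = begin
      y                     ≡⟨ *-identityˡ y ⟨
      1# *ᶠ y               ≡⟨ cong (_*ᶠ y) (inverseˡ x p·1≢0) ⟨
      ((x ⁻¹) *ᶠ x) *ᶠ y    ≡⟨ *-assoc (x ⁻¹) x y ⟩
      (x ⁻¹) *ᶠ (x *ᶠ y)    ≡⟨ cong ((x ⁻¹) *ᶠ_) (trans (sym (×1-homo-* p (product ps))) eq) ⟩
      (x ⁻¹) *ᶠ 0#          ≡⟨ zeroʳ (x ⁻¹) ⟩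
      0#                    ∎
  ...   | p′ , pr′ , d , z = p′ , pr′ , ∣.∣n⇒∣m*n p d , z

  -- Two of the `q + 1` multiples `0 · 1#, …, q · 1#` coincide, so their index difference `N ≤ q`
  -- annihilates `1#`, and so does one of its prime factors. The bound `p ≤ q` later enters the size
  -- estimate.
  characteristic : ∃ λ p → Prime p × p ≤ q × (∀ x → p · x ≡ 0#)
  characteristic with pigeonhole (ℕₚ.n<1+n q) (λ (k : Fin (suc q)) → toℕ k · 1#)
  ... | i , j , i<j , eq = go (factorise N)
    where
    N = toℕ j ℕ.∸ toℕ i
    instance
      N≢0 : NonZero N
      N≢0 = ℕ.>-nonZero (ℕₚ.m<n⇒0<n∸m i<j)
    N·1≡0 : N · 1# ≡ 0#
    N·1≡0 = +-cancelˡ (toℕ i · 1#) _ _ (begin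
      toℕ i · 1# +ᶠ N · 1#     ≡⟨ ×-homo-+ 1# (toℕ i) N ⟨
      (toℕ i + N) · 1#         ≡⟨ cong (_· 1#) (ℕₚ.m+[n∸m]≡n (ℕₚ.<⇒≤ i<j)) ⟩
      toℕ j · 1#               ≡⟨ eq ⟨
      toℕ i · 1#               ≡⟨ +-identityʳ _ ⟨
      toℕ i · 1# +ᶠ 0#         ∎)
      where open ≡-Reasoning
    go : PrimeFactorisation N → ∃ λ p → Prime p × p ≤ q × (∀ x → p · x ≡ 0#)
    go record { factors = ps ; isFactorisation = N≡ ; factorsPrime = prs }
      with prime-factor-annihilates ps prs (trans (cong (_· 1#) (sym N≡)) N·1≡0)
    ... | p , pr , p∣ , p·1≡0 = p , pr , p≤q , λ x → begin
      p · x              ≡⟨ cong (p ·_) (*-identityˡ x) ⟨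
      p · (1# *ᶠ x)      ≡⟨ ×-assoc-* p 1# x ⟨
      (p · 1#) *ᶠ x      ≡⟨ cong (_*ᶠ x) p·1≡0 ⟩
      0# *ᶠ x            ≡⟨ zeroˡ x ⟩
      0#                 ∎
      where
      open ≡-Reasoning
      p≤q : p ≤ q
      p≤q = ℕₚ.≤-trans (∣.∣⇒≤ (subst (p ∣_) (sym N≡) p∣))
              (ℕₚ.≤-trans (ℕₚ.m∸n≤m (toℕ j) (toℕ i)) (toℕ≤pred[n] j))

  -- Unit vectors and linearity of the dot product.

  single : ∀ {m} → Fin m → Fin q → Fin m → Fin q
  single i x k = if does (i ≟ k) then x else 0#

  single-at : ∀ {m} (i : Fin m) x → single i x i ≡ x
  single-at i x rewrite dec-true (i ≟ i) refl = refl

  single-off : ∀ {m} {i k : Fin m} x → i ≢ k → single i x k ≡ 0#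
  single-off {i = i} {k} x i≢k rewrite dec-false (i ≟ k) i≢k = refl

  dot-single : ∀ {n} (a : Fin n → Fin q) j x → dot 𝔽 a (single j x) ≡ a j *ᶠ x
  dot-single a j x = trans
    (sumOver-single (allFin⁺ _) (∈-allFin j)
      (λ k k≢j → trans (cong (a k *ᶠ_) (single-off x (k≢j ∘ sym))) (zeroʳ (a k))))
    (cong (a j *ᶠ_) (single-at j x))

  dot-cong : ∀ {n} (a : Fin n → Fin q) {z z′ : Fin n → Fin q} → (∀ j → z j ≡ z′ j) → dot 𝔽 a z ≡ dot 𝔽 a z′
  dot-cong a eq = sumOver-cong (allFin _) (λ j → cong (a j *ᶠ_) (eq j))

  dot-0 : ∀ {n} (a : Fin n → Fin q) → dot 𝔽 a (λ _ → 0#) ≡ 0#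
  dot-0 {n} a = sumOver-ε (allFin n) (λ {j} _ → zeroʳ (a j))

  dot-+ : ∀ {n} (a z z′ : Fin n → Fin q) → dot 𝔽 a (λ j → z j +ᶠ z′ j) ≡ dot 𝔽 a z +ᶠ dot 𝔽 a z′
  dot-+ {n} a z z′ = trans (sumOver-cong (allFin n) (λ j → distribˡ (a j) (z j) (z′ j)))
                           (sumOver-∙ (allFin n) _ _)

  sum-neg : {A : Set} (xs : List A) (f : A → Fin q) →
            sumOver xs (λ x → -ᶠ f x) ≡ -ᶠ sumOver xs f
  sum-neg []       f = sym -0#≈0#
  sum-neg (x ∷ xs) f = trans (cong (-ᶠ f x +ᶠ_) (sum-neg xs f)) (-‿+-comm _ _)

  dot-neg : ∀ {n} (a z : Fin n → Fin q) → dot 𝔽 a (λ j → -ᶠ z j) ≡ -ᶠ dot 𝔽 a z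
  dot-neg {n} a z = trans (sumOver-cong (allFin n) (λ j → sym (-‿distribʳ-* (a j) (z j))))
                          (sum-neg (allFin n) _)

  infix 4 _≡_[mod_]
  _≡_[mod_] : ℤ → ℤ → ℕ → Set
  x ≡ y [mod p ] = + p ∣ℤ.∣ x ℤ.- y

  -- Certificates of unsatisfiability.

  module _ {n m : ℕ} (F : Fin m → Equation q n) where

    -- weight i j α = φ_i(a_ij α) and target i = φ_i(b_i), as representatives in {0,…,p-1}.
    record Certificate : Set where
      field
        p       : ℕ
        0<p     : 1 ≤ p
        p≤q     : p ≤ q
        weight  : Fin m → Fin n → Fin q → ℕ
        target  : Fin m → ℕ
        weight≤ : ∀ i j α → weight i j α ≤ p
        weight0 : ∀ i j α → coeffs (F i) j ≡ 0# → weight i j α ≡ 0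
        rows    : ∀ i σ → Sat 𝔽 σ (F i) →
                  + sumℕ (allFin n) (λ j → weight i j (σ j)) ≡ + target i [mod p ]
        columns : ∀ j α → p ∣ sumℕ (allFin m) (λ i → weight i j α)
        targets : ¬ p ∣ sumℕ (allFin m) target

    module _ (unsat : Unsatisfiable 𝔽 F) where

      private
        𝔽^m : CommutativeMonoid 0ℓ 0ℓ
        𝔽^m = Pointwise.commutativeMonoid (Fin m) +-commutativeMonoid

      open CommutativeMonoid 𝔽^m using (_≈_)
      open SumOver 𝔽^m using () renaming (sumOver to sumᵛ)
      open import Algebra.Properties.CommutativeMonoid.Mult 𝔽^m using () renaming (_×_ to _·ᵛ_)

      ·ᵛ-pointwise : ∀ k x i → (k ·ᵛ x) i ≡ k · x i
      ·ᵛ-pointwise zero    x i = refl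
      ·ᵛ-pointwise (suc k) x i = cong (x i +ᶠ_) (·ᵛ-pointwise k x i)

      sumᵛ-pointwise : {A : Set} (xs : List A) (f : A → Fin m → Fin q) (i : Fin m) →
                       sumᵛ xs f i ≡ sumOver xs (λ x → f x i)
      sumᵛ-pointwise []       f i = refl
      sumᵛ-pointwise (x ∷ xs) f i = cong (f x i +ᶠ_) (sumᵛ-pointwise xs f i)

      sumᵛ-basis : ∀ w → sumᵛ (allFin m) (λ i → single i (w i)) ≈ w
      sumᵛ-basis w k = trans (sumᵛ-pointwise (allFin m) _ k)
        (trans (sumOver-single (allFin⁺ m) (∈-allFin k) (λ i i≢k → single-off (w i) i≢k))
               (single-at k (w k)))

      sumᵛ-single : {A : Set} (xs : List A) (i : Fin m) (f : A → Fin q) →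
                    sumᵛ xs (λ x → single i (f x)) ≈ single i (sumOver xs f)
      sumᵛ-single xs i f k = trans (sumᵛ-pointwise xs _ k) (lemma (i ≟ k))
        where
        lemma : (d : Dec (i ≡ k)) → sumOver xs (λ x → if does d then f x else 0#) ≡
                                    (if does d then sumOver xs f else 0#)
        lemma (yes _) = refl
        lemma (no _)  = sumOver-ε xs (λ _ → refl)

      certificate : Certificate
      certificate with characteristic
      ... | p , pr , p≤q , exp = build (saturate exponent -b generators image -b∉image)
        where
        open PrimeExponent 𝔽^m pr
        open Submonoid

        exponent : ∀ x → p ·ᵛ x ≈ (λ _ → 0#)
        exponent x i = trans (·ᵛ-pointwise p x i) (exp (x i))

        image : Submonoid
        image = record
          { Mem  = λ w → ∃ λ z → ∀ i → dot 𝔽 (coeffs (F i)) z ≡ w i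
          ; mem? = λ w → map′ (λ (k , h) → finToFun k , h)
              (λ (z , h) → funToFin z , λ i → trans (dot-cong (coeffs (F i)) (finToFun-funToFin z)) (h i))
              -- An exhaustive search over all assignments, coded as elements of `Fin (q ^ n)`.
              (any? λ k → all? λ i → dot 𝔽 (coeffs (F i)) (finToFun k) ≟ w i)
          ; resp = λ x≈y (z , h) → z , λ i → trans (h i) (x≈y i)
          ; ε∈   = (λ _ → 0#) , λ i → dot-0 (coeffs (F i))
          ; ∙∈   = λ (z , h) (z′ , h′) → (λ j → z j +ᶠ z′ j) ,
                     λ i → trans (dot-+ (coeffs (F i)) z z′) (cong₂ _+ᶠ_ (h i) (h′ i))
          }

        -- Separating `-b` rather than `b` from the image gives the functional the value 1 at `b`,
        -- because `b + 1 · (-b)` is zero.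
        b -b : Fin m → Fin q
        b i = rhs (F i)
        -b i = -ᶠ b i

        -b∉image : ¬ Mem image -b
        -b∉image (z , h) = unsat ((λ j → -ᶠ z j) , λ i →
          trans (dot-neg (coeffs (F i)) z) (trans (cong -ᶠ_ (h i)) (-‿involutive (b i))))

        generators : List (Fin m → Fin q)
        generators = cartesianProductWith single (allFin m) (allFin q)

        build : Σ Submonoid (λ K → image ⊑ K × ¬ Mem K -b ×
                  (∀ {u} → u ∈ generators → Mem (adjoin exponent K -b) u)) → Certificate
        build (K , image⊑K , -b∉K , all) = record
          { p       = p
          ; 0<p     = ℕ.>-nonZero⁻¹ p
          ; p≤q     = p≤q
          ; weight  = λ i j α → g i (coeffs (F i) j *ᶠ α)
          ; target  = λ i → g i (b i)
          ; weight≤ = λ i j α → ℕₚ.<⇒≤ (g<p i _)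
          ; weight0 = λ i j α a≡0 → trans (cong (g i) (trans (cong (_*ᶠ α) a≡0) (zeroˡ α))) (g0 i)
          -- If row `i` holds under `σ`, then `single i (b i)` is the sum of the vectors
          -- `single i (a_ij σ_j)`, so both ways of evaluating the functional agree mod p.
          ; rows    = λ i σ sat → unique (g i (b i)) _ (value-g i (b i))
              (value-resp (sumℕ (allFin n) (λ j → g i (coeffs (F i) j *ᶠ σ j)))
                (λ k → trans (sumᵛ-single (allFin n) i _ k) (cong (λ x → single i x k) sat))
                (value-sum (allFin n) (λ j → value-g i (coeffs (F i) j *ᶠ σ j))))
          -- The column `(a_ij α)_i` is the image of `single j α`, where the functional vanishes.
          ; columns = λ j α → vanish (λ i → coeffs (F i) j *ᶠ α)
              (image⊑K (single j α , λ i → dot-single (coeffs (F i)) j α))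
          -- The targets sum to a value of the functional at `b`, and 1 is another such value; were
          -- the sum divisible by p, so would be 1.
          ; targets = λ d → ¬p∣1 (∣.∣m+n∣m⇒∣n
              (value-unique {t = sumℕ (allFin m) (λ i → g i (b i))} {1} (value-total b) value-b)
              (∣.∣n⇒∣m*n (ℕ.pred p) d))
          }
          where
          open Functional exponent K -b -b∉K

          instance
            p≢0 : NonZero p
            p≢0 = prime⇒nonZero pr

          raw : ∀ i x → Mem (adjoin exponent K -b) (single i x)
          raw i x = all (∈-cartesianProductWith⁺ single (∈-allFin i) (∈-allFin x))

          g : Fin m → Fin q → ℕ
          g i x = proj₁ (raw i x) % p

          g<p : ∀ i x → g i x ℕ.< p
          g<p i x = m%n<n (proj₁ (raw i x)) p

          value-g : ∀ i x → Value (single i x) (g i x)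
          value-g i x = value-% {t = proj₁ (raw i x)} (proj₂ (raw i x))

          value-total : ∀ w → Value w (sumℕ (allFin m) (λ i → g i (w i)))
          value-total w = value-resp (sumℕ (allFin m) (λ i → g i (w i))) (sumᵛ-basis w)
            (value-sum (allFin m) (λ i → value-g i (w i)))

          -- Subtracting the multiple `p * t` turns the subtraction-free form of `value-unique` into
          -- a congruence of integers.
          unique : ∀ {u} t t′ → Value u t → Value u t′ → + t′ ≡ + t [mod p ]
          unique t t′ h h′ = subst (+ p ∣ℤ.∣_) eq
            (∣ℤ.∣m∣n⇒∣m-n (∣ℤ.∣ᵤ⇒∣ {+ p} {+ (ℕ.pred p * t + t′)} (value-unique {t = t} {t′} h h′))
                          (∣ℤ.∣ᵤ⇒∣ {+ p} {+ (p * t)} (∣.m∣m*n t)))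
            where
            eq : + (ℕ.pred p * t + t′) ℤ.- + (p * t) ≡ + t′ ℤ.- + t
            eq = trans (cong₂ ℤ._-_
                   (trans (ℤₚ.pos-+ (ℕ.pred p * t) t′) (cong (λ z → z ℤ.+ + t′) (ℤₚ.pos-* (ℕ.pred p) t)))
                   (trans (cong (λ r → + (r * t)) (sym (ℕₚ.suc-pred p)))
                     (trans (ℤₚ.pos-* (suc (ℕ.pred p)) t) (cong (ℤ._* + t) (ℤₚ.pos-+ 1 (ℕ.pred p))))))
                   (lemma (+ ℕ.pred p) (+ t) (+ t′))
              where
              lemma : ∀ r t t′ → r ℤ.* t ℤ.+ t′ ℤ.- (+ 1 ℤ.+ r) ℤ.* t ≡ t′ ℤ.- t
              lemma = solve-∀

          vanish : ∀ w → Mem K w → p ∣ sumℕ (allFin m) (λ i → g i (w i))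
          vanish w w∈ = subst (λ k → p ∣ k + sumℕ (allFin m) (λ i → g i (w i))) (ℕₚ.*-zeroʳ (ℕ.pred p))
            (value-unique {t = 0} (value-∈ w∈) (value-total w))

          -- A residue below p that is divisible by p is zero as an integer. Exact zero is what
          -- removes the variables outside the support from the integer form of a row.
          g0 : ∀ i → g i 0# ≡ 0
          g0 i = trans (sym (m<n⇒m%n≡m (g<p i 0#))) (∣.n∣m⇒m%n≡0 (g i 0#) p p∣g0)
            where
            zero∈ : Mem K (single i 0#)
            zero∈ = resp K (λ k → sym (single-0 (i ≟ k))) (ε∈ K)
              where
              single-0 : ∀ {k} (d : Dec (i ≡ k)) → (if does d then 0# else 0#) ≡ 0#
              single-0 (yes _) = refl
              single-0 (no _)  = refl
            p∣g0 : p ∣ g i 0#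
            p∣g0 = subst (λ k → p ∣ k + g i 0#) (ℕₚ.*-zeroʳ (ℕ.pred p))
              (value-unique {t = 0} {g i 0#} (value-∈ zero∈) (value-g i 0#))

          value-b : Value b 1
          value-b = resp K (λ i → sym (trans (cong (b i +ᶠ_) (+-identityʳ (-b i))) (-‿inverseʳ (b i)))) (ε∈ K)

          ¬p∣1 : ¬ p ∣ 1
          ¬p∣1 d = ¬prime[1] (subst Prime (∣.∣1⇒≡1 d) pr)

-- Bounds on sums of natural numbers.

sumℕ-≤ : {A : Set} (xs : List A) {f : A → ℕ} {k : ℕ} → (∀ x → f x ≤ k) → sumℕ xs f ≤ length xs * k
sumℕ-≤ []       le = z≤n
sumℕ-≤ (x ∷ xs) le = ℕₚ.+-mono-≤ (le x) (sumℕ-≤ xs le)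

sumℕ-filter-≤ : {A : Set} {P : A → Set} (P? : ∀ x → Dec (P x)) (xs : List A) {f : A → ℕ} {k : ℕ} →
                (∀ x → f x ≤ k) → (∀ x → ¬ P x → f x ≡ 0) → sumℕ xs f ≤ length (filter P? xs) * k
sumℕ-filter-≤ P? []       le off = z≤n
sumℕ-filter-≤ P? (x ∷ xs) le off with P? x
... | yes _  = ℕₚ.+-mono-≤ (le x) (sumℕ-filter-≤ P? xs le off)
... | no ¬Px rewrite off x ¬Px = sumℕ-filter-≤ P? xs le off

module Refuting {q n m : ℕ} (𝔽 : FiniteField q) (F : Fin m → Equation q n) where
  open FieldFacts 𝔽 using (Certificate; _≡_[mod_])
  open FiniteField 𝔽 using (0#)
  open Derivation (Input 𝔽 F) public

  -- Integer forms in the Boolean variables.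

  Var : Set
  Var = BVar 𝔽 n

  unitᶠ : Var → Var → ℤ
  unitᶠ = unit 𝔽

  unitℕ : Var → Var → ℕ
  unitℕ v w = ℤ.∣ unitᶠ v w ∣

  unit-pos : ∀ v w → unitᶠ v w ≡ + unitℕ v w
  unit-pos (j , α) (k , β) with j ≟ k | α ≟ β
  ... | yes _ | yes _ = refl
  ... | yes _ | no _  = refl
  ... | no _  | yes _ = refl
  ... | no _  | no _  = refl

  unitℕ-≡ : ∀ v → unitℕ v v ≡ 1
  unitℕ-≡ (j , α) with j ≟ j | α ≟ α
  ... | yes _ | yes _   = refl
  ... | yes _ | no α≢α  = contradiction refl α≢α
  ... | no j≢j | _      = contradiction refl j≢j

  unitℕ-≢ : ∀ v w → v ≢ w → unitℕ v w ≡ 0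
  unitℕ-≢ (j , α) (k , β) v≢w with j ≟ k | α ≟ β
  ... | yes refl | yes refl = contradiction refl v≢w
  ... | yes _ | no _  = refl
  ... | no _  | yes _ = refl
  ... | no _  | no _  = refl

  Coeffs : Set
  Coeffs = Fin n → Fin q → ℕ

  form : Coeffs → Var → ℤ
  form c (j , α) = + c j α

  Σᵛ : Coeffs → ℕ
  Σᵛ c = sumℕ (allFin n) (λ j → sumℕ (allFin q) (c j))

  Σᵛ-unit : ∀ (c : Coeffs) k β → Σᵛ (λ j α → c j α * unitℕ (j , α) (k , β)) ≡ c k β
  Σᵛ-unit c k β = begin
    Σᵛ (λ j α → c j α * unitℕ (j , α) (k , β))
      ≡⟨ sumℕ-single (allFin⁺ n) (∈-allFin k) (λ j j≢k →
           sumℕ-zero (allFin q) (λ {α} _ → off j α (j≢k ∘ cong proj₁))) ⟩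
    sumℕ (allFin q) (λ α → c k α * unitℕ (k , α) (k , β))
      ≡⟨ sumℕ-single (allFin⁺ q) (∈-allFin β) (λ α α≢β → off k α (α≢β ∘ cong proj₂)) ⟩
    c k β * unitℕ (k , β) (k , β)
      ≡⟨ cong (c k β *_) (unitℕ-≡ (k , β)) ⟩
    c k β * 1
      ≡⟨ ℕₚ.*-identityʳ (c k β) ⟩
    c k β ∎
    where
    open ≡-Reasoning
    off : ∀ j α → (j , α) ≢ (k , β) → c j α * unitℕ (j , α) (k , β) ≡ 0
    off j α ne = trans (cong (c j α *_) (unitℕ-≢ (j , α) (k , β) ne)) (ℕₚ.*-zeroʳ (c j α))

  -- Bounds on single variables are scaled by their coefficients and added; `Σᵛ-unit` recognises the
  -- total as `form c`. The first alternative covers coefficient 0, as for variables outside a row's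
  -- support, whose values are not known.
  form-⊢ : ∀ {path} (s : ℤ) (c u : Coeffs) →
           (∀ j α → c j α ≡ 0 ⊎ path ⊢ (λ w → s ℤ.* unitᶠ (j , α) w) ≥ s ℤ.* + u j α) →
           path ⊢ (λ v → s ℤ.* form c v) ≥ s ℤ.* + Σᵛ (λ j α → c j α * u j α)
  form-⊢ {path} s c u ds =
    conv (λ (k , β) → cong (λ x → s ℤ.* + x) (Σᵛ-unit c k β)) ℤₚ.≤-refl
      (sum-⊢ s (allFin n) _ _ (λ j → sum-⊢ s (allFin q) _ _ (λ α → term j α (ds j α))))
    where
    shuffle : ∀ s c x → c ℤ.* (s ℤ.* x) ≡ s ℤ.* (c ℤ.* x)
    shuffle = solve-∀
    weighted : ∀ k x → + k ℤ.* (s ℤ.* + x) ≡ s ℤ.* + (k * x)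
    weighted k x = trans (shuffle s (+ k) (+ x)) (cong (s ℤ.*_) (sym (ℤₚ.pos-* k x)))
    term : ∀ j α → (c j α ≡ 0 ⊎ path ⊢ (λ w → s ℤ.* unitᶠ (j , α) w) ≥ s ℤ.* + u j α) →
           path ⊢ (λ w → s ℤ.* + (c j α * unitℕ (j , α) w)) ≥ s ℤ.* + (c j α * u j α)
    term j α (inj₁ c≡0) rewrite c≡0 =
      conv (λ _ → sym (ℤₚ.*-zeroʳ s)) (ℤₚ.≤-reflexive (ℤₚ.*-zeroʳ s)) triv
    term j α (inj₂ d) =
      conv (λ w → trans (cong (λ x → + c j α ℤ.* (s ℤ.* x)) (unit-pos (j , α) w))
                        (weighted (c j α) (unitℕ (j , α) w)))
           (ℤₚ.≤-reflexive (sym (weighted (c j α) (u j α))))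
           (scale (c j α) d)

  positive : ∀ {path} {a : Var → ℤ} {b} → path ⊢ (λ v → + 1 ℤ.* a v) ≥ + 1 ℤ.* b → path ⊢ a ≥ b
  positive = conv (λ v → ℤₚ.*-identityˡ _) (ℤₚ.≤-reflexive (sym (ℤₚ.*-identityˡ _)))

  positive⁻ : ∀ {path} {a : Var → ℤ} {b} → path ⊢ a ≥ b → path ⊢ (λ v → + 1 ℤ.* a v) ≥ + 1 ℤ.* b
  positive⁻ = conv (λ v → sym (ℤₚ.*-identityˡ _)) (ℤₚ.≤-reflexive (ℤₚ.*-identityˡ _))

  negative : ∀ {path} {a : Var → ℤ} {b} → path ⊢ (λ v → ℤ.- (+ 1) ℤ.* a v) ≥ ℤ.- (+ 1) ℤ.* b →
             path ⊢ (λ v → ℤ.- a v) ≥ ℤ.- b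
  negative {a = a} {b} = conv (λ v → ℤₚ.-1*i≡-i (a v)) (ℤₚ.≤-reflexive (sym (ℤₚ.-1*i≡-i b)))

  negative⁻ : ∀ {path} {a : Var → ℤ} {b} → path ⊢ (λ v → ℤ.- a v) ≥ ℤ.- b →
              path ⊢ (λ v → ℤ.- (+ 1) ℤ.* a v) ≥ ℤ.- (+ 1) ℤ.* b
  negative⁻ {a = a} {b} = conv (λ v → sym (ℤₚ.-1*i≡-i (a v))) (ℤₚ.≤-reflexive (ℤₚ.-1*i≡-i b))

  form-≥0 : ∀ {path} (c : Coeffs) → path ⊢ form c ≥ + 0
  form-≥0 c = conv (λ _ → refl) (ℤ.+≤+ z≤n)
    (positive (form-⊢ (+ 1) c (λ _ _ → 0) (λ j α → inj₂ (positive⁻ (input (lower (j , α)))))))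

  form-≤Σᵛ : ∀ {path} (c : Coeffs) → path ⊢ (λ v → ℤ.- form c v) ≥ ℤ.- (+ Σᵛ c)
  form-≤Σᵛ c = conv (λ _ → refl) (ℤₚ.≤-reflexive (cong (λ x → ℤ.- (+ x)) Σc≡))
    (negative {a = form c} {b = + Σᵛ (λ j α → c j α * 1)} (form-⊢ (ℤ.- (+ 1)) c (λ _ _ → 1) (λ j α →
      inj₂ (negative⁻ {a = unitᶠ (j , α)} {+ 1} (input (upper (j , α)))))))
    where
    Σc≡ : Σᵛ c ≡ Σᵛ (λ j α → c j α * 1)
    Σc≡ = sumℕ-cong (allFin n) (λ j → sumℕ-cong (allFin q) (λ α → sym (ℕₚ.*-identityʳ (c j α))))

  clash : ∀ {path a x y} → path ⊢ a ≥ x → path ⊢ (λ v → ℤ.- a v) ≥ ℤ.- y → y ℤ.< x → Absurd path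
  clash {a = a} {x} {y} lo hi y<x = conv (λ v → ℤₚ.+-inverseʳ (a v)) 1≤x-y (add lo hi)
    where
    1≤x-y : + 1 ℤ.≤ x ℤ.- y
    1≤x-y = ℤₚ.≤-trans (ℤₚ.≤-reflexive (sym (lemma y))) (ℤₚ.+-monoˡ-≤ (ℤ.- y) (ℤₚ.i<j⇒suc[i]≤j y<x))
      where
      lemma : ∀ y → (+ 1 ℤ.+ y) ℤ.- y ≡ + 1
      lemma = solve-∀

  -- Contradictions from clauses and branching on field values.

  -- Each bound `x_(j,σ j) ≥ 1` cancels one negative literal and its `-1` on the right, until only
  -- the empty clause `0 ≥ 1` remains.
  equation-absurd : ∀ {path} (σ : Fin n → Fin q) (js : List (Fin n)) →
    (∀ {j} → j ∈ js → path ⊢ unitᶠ (j , σ j) ≥ + 1) →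
    (let I = clauseIneq 𝔽 (foldr (λ j c → ((j , σ j) , false) ∷ c) [] js)
     in path ⊢ proj₁ I ≥ proj₂ I) → Absurd path
  equation-absurd σ []       known d = d
  equation-absurd σ (j ∷ js) known d = equation-absurd σ js (known ∘ there)
    (conv (λ v → cancel (unitᶠ (j , σ j) v) _) (ℤₚ.≤-reflexive (sym (cancel′ (+ 1) _)))
      (add (known (here refl)) d))
    where
    cancel : ∀ x y → x ℤ.+ ((ℤ.- x) ℤ.+ y) ≡ y
    cancel = solve-∀
    cancel′ : ∀ x y → x ℤ.+ (y ℤ.- x) ≡ y
    cancel′ = solve-∀

  atLeastOne-absurd : ∀ {path} j (αs : List (Fin q)) →
    (∀ α → path ⊢ (λ v → ℤ.- unitᶠ (j , α) v) ≥ + 0) →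
    (let I = clauseIneq 𝔽 (foldr (λ α c → ((j , α) , true) ∷ c) [] αs)
     in path ⊢ proj₁ I ≥ proj₂ I) → Absurd path
  atLeastOne-absurd j []       known d = d
  atLeastOne-absurd j (α ∷ αs) known d = atLeastOne-absurd j αs known
    (conv (λ v → cancel (unitᶠ (j , α) v) _) (ℤₚ.≤-reflexive (sym (ℤₚ.+-identityˡ _)))
      (add (known α) d))
    where
    cancel : ∀ x y → (ℤ.- x) ℤ.+ (x ℤ.+ y) ≡ y
    cancel = solve-∀

  excluded : ∀ {path j α β} → α ≢ β → path ⊢ unitᶠ (j , α) ≥ + 1 →
             path ⊢ (λ v → ℤ.- unitᶠ (j , β) v) ≥ + 0
  excluded {j = j} {α} {β} α≢β d =
    conv (λ v → cancel (unitᶠ (j , α) v) (unitᶠ (j , β) v)) ℤₚ.≤-refl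
      (add d (input (clause _ (atMostOne j α β α≢β))))
    where
    cancel : ∀ x y → x ℤ.+ ((ℤ.- x) ℤ.+ ((ℤ.- y) ℤ.+ + 0)) ≡ ℤ.- y
    cancel = solve-∀

  -- The queries ask `x_(j,α) ≥ 1` for one value after another. `known` says that every value is
  -- still pending or already excluded; when none is pending, the at-least-one clause fails, which
  -- is the extra leaf in the count.
  branch-value : ∀ {path s} j (αs : List (Fin q)) →
    (∀ α → α ∈ αs ⊎ path ⊢ (λ v → ℤ.- unitᶠ (j , α) v) ≥ + 0) →
    (∀ α {path′} → path ⊆ path′ → path′ ⊢ unitᶠ (j , α) ≥ + 1 → Refutable path′ s) →
    Refutable path (suc (length αs * s))
  branch-value j [] known K =
    refutable-leaf (atLeastOne-absurd j (allFin q) (λ α → excl (known α)) (input (clause _ (atLeastOne j))))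
    where
    excl : ∀ {α path} → α ∈ [] ⊎ path ⊢ (λ v → ℤ.- unitᶠ (j , α) v) ≥ + 0 →
           path ⊢ (λ v → ℤ.- unitᶠ (j , α) v) ≥ + 0
    excl (inj₂ d) = d
  branch-value {path} {s} j (α ∷ αs) known K =
    refutable-mono (ℕₚ.≤-reflexive (cong suc (ℕₚ.+-comm (length αs * s) s)))
      (query (unitᶠ (j , α)) (+ 1)
        (branch-value j αs (λ β → step (known β)) (λ β sub → K β (sub ∘ there)))
        (K α there (hyp (here refl))))
    where
    step : ∀ {β} → β ∈ α ∷ αs ⊎ path ⊢ (λ v → ℤ.- unitᶠ (j , β) v) ≥ + 0 →
           β ∈ αs ⊎ _ ⊢ (λ v → ℤ.- unitᶠ (j , β) v) ≥ + 0
    step (inj₁ (here refl)) = inj₂ (hyp (here refl))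
    step (inj₁ (there β∈))  = inj₁ β∈
    step (inj₂ d)           = inj₂ (weaken there d)

  -- This is 1 + q + ... + q^l; each branching on a variable adds one leaf for the case that it
  -- takes no value.
  assignmentLeaves : ℕ → ℕ
  assignmentLeaves zero    = 1
  assignmentLeaves (suc l) = suc (q * assignmentLeaves l)

  branch-assignment : ∀ {path} (js : List (Fin n)) →
    (∀ {path′} → path ⊆ path′ → (σ : Fin n → Fin q) →
      (∀ {j} → j ∈ js → path′ ⊢ unitᶠ (j , σ j) ≥ + 1) → Absurd path′) →
    Refutable path (assignmentLeaves (length js))
  -- Variables outside the list receive the default value `0#`.
  branch-assignment []       K = refutable-leaf (K id (λ _ → 0#) (λ ()))
  branch-assignment (j ∷ js) K =
    subst (λ l → Refutable _ (suc (l * assignmentLeaves (length js)))) (length-tabulate {n = q} id)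
      (branch-value j (allFin q) (λ α → inj₁ (∈-allFin α)) λ α sub d →
        branch-assignment js λ sub′ σ known →
          K (sub′ ∘ sub) (λ k → if does (j ≟ k) then α else σ k)
            (update α σ (weaken sub′ d) known))
    where
    update : ∀ {path} α σ → path ⊢ unitᶠ (j , α) ≥ + 1 →
             (∀ {k} → k ∈ js → path ⊢ unitᶠ (k , σ k) ≥ + 1) →
             ∀ {k} → k ∈ j ∷ js → path ⊢ unitᶠ (k , (if does (j ≟ k) then α else σ k)) ≥ + 1
    update α σ d known {k} k∈ with j ≟ k
    update α σ d known {k} k∈           | yes refl = d
    update α σ d known {k} (here refl)  | no j≢k   = contradiction refl j≢k
    update α σ d known {k} (there k∈)   | no _     = known k∈

  -- Values of forms under an assignment.

  module _ (σ : Fin n → Fin q) where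

    indicator : Coeffs
    indicator j α = if does (σ j ≟ α) then 1 else 0

    Σᵛ-indicator : ∀ (c : Coeffs) → Σᵛ (λ j α → c j α * indicator j α) ≡ sumℕ (allFin n) (λ j → c j (σ j))
    Σᵛ-indicator c = sumℕ-cong (allFin n) (λ j →
      trans (sumℕ-single (allFin⁺ q) (∈-allFin (σ j)) (λ α α≢ → off j (α≢ ∘ sym))) (at j))
      where
      off : ∀ j {α} → σ j ≢ α → c j α * indicator j α ≡ 0
      off j {α} ne rewrite dec-false (σ j ≟ α) ne = ℕₚ.*-zeroʳ (c j α)
      at : ∀ j → c j (σ j) * indicator j (σ j) ≡ c j (σ j)
      at j rewrite dec-true (σ j ≟ σ j) refl = ℕₚ.*-identityʳ (c j (σ j))

    indicator-≥ : ∀ {path j} α → path ⊢ unitᶠ (j , σ j) ≥ + 1 →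
                  path ⊢ unitᶠ (j , α) ≥ + indicator j α
    indicator-≥ {j = j} α d with σ j ≟ α
    ... | yes refl = d
    ... | no  _    = input (lower (j , α))

    indicator-≤ : ∀ {path j} α → path ⊢ unitᶠ (j , σ j) ≥ + 1 →
                  path ⊢ (λ v → ℤ.- unitᶠ (j , α) v) ≥ ℤ.- (+ indicator j α)
    indicator-≤ {j = j} α d with σ j ≟ α
    ... | yes refl = input (upper (j , α))
    ... | no  σj≢α = excluded σj≢α d

    -- For an assigned variable, `x_(j,σ j)` is pinned to 1 and, by the at-most-one clauses and
    -- nonnegativity, every other `x_(j,α)` to 0.
    form-assigned : ∀ {path} (c : Coeffs) →
      (∀ j → (∀ α → c j α ≡ 0) ⊎ path ⊢ unitᶠ (j , σ j) ≥ + 1) →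
      (let s = sumℕ (allFin n) (λ j → c j (σ j)) in
       path ⊢ form c ≥ + s × path ⊢ (λ v → ℤ.- form c v) ≥ ℤ.- (+ s))
    form-assigned {path} c known =
      conv (λ _ → refl) (ℤₚ.≤-reflexive (cong +_ (sym (Σᵛ-indicator c))))
        (positive (form-⊢ (+ 1) c indicator (λ j α → map (λ z → z α)
          (λ d → positive⁻ (indicator-≥ α d)) (known j)))) ,
      conv (λ _ → refl) (ℤₚ.≤-reflexive (cong (λ x → ℤ.- (+ x)) (sym (Σᵛ-indicator c))))
        (negative {a = form c} {+ Σᵛ (λ j α → c j α * indicator j α)}
          (form-⊢ (ℤ.- (+ 1)) c indicator (λ j α → map (λ z → z α)
            (λ d → negative⁻ {a = unitᶠ (j , α)} {+ indicator j α} (indicator-≤ α d)) (known j))))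

  -- Divide and conquer over the rows.

  module _ (C : Certificate F) {d : ℕ} (width : Width≤ 𝔽 d F) where
    open Certificate C

    rowForm : List (Fin m) → Coeffs
    rowForm is j α = sumℕ is (λ i → weight i j α)

    rowSum : List (Fin m) → ℕ
    rowSum is = sumℕ is target

    -- At most `d` variables matter in a row, each with `q` values of weight at most `p`.
    rowBound : ℕ
    rowBound = d * (q * p)

    weight-total : ∀ i → Σᵛ (weight i) ≤ rowBound
    weight-total i = ℕₚ.≤-trans
      (sumℕ-filter-≤ (λ j → ¬? (coeffs (F i) j ≟ 0#)) (allFin n)
        (λ j → subst (λ l → sumℕ (allFin q) (weight i j) ≤ l * p) (length-tabulate {n = q} id)
                 (sumℕ-≤ (allFin q) (weight≤ i j)))
        off)
      (ℕₚ.*-monoˡ-≤ (q * p) (width i))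
      where
      off : ∀ j → ¬ ¬ coeffs (F i) j ≡ 0# → sumℕ (allFin q) (weight i j) ≡ 0
      off j ¬¬a≡0 with coeffs (F i) j ≟ 0#
      ... | yes a≡0 = sumℕ-zero (allFin q) (λ {α} _ → weight0 i j α a≡0)
      ... | no  a≢0 = contradiction a≢0 ¬¬a≡0

    rowForm-≤ : ∀ {path} is {B} → length is * rowBound ≤ B →
                path ⊢ (λ v → ℤ.- form (rowForm is) v) ≥ ℤ.- (+ B)
    rowForm-≤ is le = conv (λ _ → refl)
      (ℤₚ.neg-mono-≤ (ℤ.+≤+ (ℕₚ.≤-trans (sumℕ-≤ is weight-total) le)))
      (negative {a = form (rowForm is)} {+ sumℕ is (λ i → Σᵛ (weight i))}
        (sum-⊢ (ℤ.- (+ 1)) is (λ i (j , α) → weight i j α) (λ i → Σᵛ (weight i))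
          (λ i → negative⁻ {a = form (weight i)} {+ Σᵛ (weight i)} (form-≤Σᵛ (weight i)))))

    -- An assignment falsifying the row violates one of its clauses. One satisfying it forces the
    -- form to an integer congruent to the target, hence different from `v`, and two distinct values
    -- clash.
    row-absurd : ∀ {path} i (σ : Fin n → Fin q) {v} →
      (∀ {j} → j ∈ support 𝔽 (coeffs (F i)) → path ⊢ unitᶠ (j , σ j) ≥ + 1) →
      ¬ v ≡ + target i [mod p ] →
      path ⊢ form (weight i) ≥ v → path ⊢ (λ w → ℤ.- form (weight i) w) ≥ ℤ.- v → Absurd path
    row-absurd {path} i σ {v} known v≢ lo hi with dot 𝔽 (coeffs (F i)) σ ≟ rhs (F i)
    ... | no unsat = equation-absurd σ (support 𝔽 (coeffs (F i))) known (input (clause _ (equation i σ unsat)))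
    ... | yes sat = compare (form-assigned σ (weight i) known′)
      where
      known′ : ∀ j → (∀ α → weight i j α ≡ 0) ⊎ path ⊢ unitᶠ (j , σ j) ≥ + 1
      known′ j with coeffs (F i) j ≟ 0#
      ... | yes a≡0 = inj₁ (λ α → weight0 i j α a≡0)
      ... | no  a≢0 = inj₂ (known (∈-filter⁺ (λ j → ¬? (coeffs (F i) j ≟ 0#)) (∈-allFin j) a≢0))
      w : ℤ
      w = + sumℕ (allFin n) (λ j → weight i j (σ j))
      compare : path ⊢ form (weight i) ≥ w × path ⊢ (λ v → ℤ.- form (weight i) v) ≥ ℤ.- w → Absurd path
      compare (≥w , ≤w) with ℤₚ.<-cmp v w
      ... | tri< v<w _ _ = clash ≥w hi v<w
      ... | tri≈ _ v≡w _ = contradiction (subst (_≡ + target i [mod p ]) (sym v≡w) (rows i σ sat)) v≢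
      ... | tri> _ _ w<v = clash lo ≤w w<v

    1≤assignmentLeaves : ∀ l → 1 ≤ assignmentLeaves l
    1≤assignmentLeaves zero    = ℕₚ.≤-refl
    1≤assignmentLeaves (suc l) = s≤s z≤n

    assignmentLeaves-mono : ∀ {l l′} → l ≤ l′ → assignmentLeaves l ≤ assignmentLeaves l′
    assignmentLeaves-mono {l′ = l′} z≤n = 1≤assignmentLeaves l′
    assignmentLeaves-mono (s≤s le)      = s≤s (ℕₚ.*-monoʳ-≤ q (assignmentLeaves-mono le))

    module _ (B : ℕ) (B-bound : m * rowBound ≤ B) where

      length-bound : ∀ (is : List (Fin m)) → length is ≤ m → length is * rowBound ≤ B
      length-bound is len≤m = ℕₚ.≤-trans (ℕₚ.*-monoˡ-≤ rowBound len≤m) B-bound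

      -- The invariant is that the sum of the rows in `is` is pinned to an integer `v` that is wrong
      -- mod p. Each round queries the value of one half and passes to a half that is again wrong.
      refute-rows : ∀ k (is : List (Fin m)) {path v} → length is ≤ 2 ^ k → length is ≤ m →
        path ⊢ form (rowForm is) ≥ v → path ⊢ (λ w → ℤ.- form (rowForm is) w) ≥ ℤ.- v →
        ¬ v ≡ + rowSum is [mod p ] →
        Refutable path (suc B ^ k * assignmentLeaves d)
      -- `drop` can leave no rows; the form is then 0 with target 0, so a wrong `v` is a nonzero
      -- integer.
      refute-rows zero [] {path} {v} _ _ lo hi v≢ =
        refutable-mono (ℕₚ.≤-trans (1≤assignmentLeaves d) (ℕₚ.≤-reflexive (sym (ℕₚ.*-identityˡ _))))
          (refutable-leaf absurd)
        where
        absurd : Absurd path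
        absurd with ℤₚ.<-cmp v (+ 0)
        ... | tri< v<0 _ _ = clash (conv (λ _ → refl) ℤₚ.≤-refl triv) hi v<0
        ... | tri≈ _ v≡0 _ = contradiction
                (∣ℤ.divides (+ 0) (trans (ℤₚ.+-identityʳ v) v≡0)) v≢
        ... | tri> _ _ 0<v = clash lo (conv (λ _ → refl) ℤₚ.≤-refl triv) 0<v
      refute-rows zero (i ∷ []) {path} {v} _ _ lo hi v≢ =
        refutable-mono (ℕₚ.≤-trans (assignmentLeaves-mono (width i))
                                   (ℕₚ.≤-reflexive (sym (ℕₚ.*-identityˡ _))))
          (branch-assignment (support 𝔽 (coeffs (F i))) λ sub σ known →
            row-absurd i σ known
              (λ v≡ → v≢ (subst (λ t → v ≡ + t [mod p ]) (sym (ℕₚ.+-identityʳ (target i))) v≡))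
              (weaken sub (conv (λ (j , α) → cong +_ (ℕₚ.+-identityʳ (weight i j α))) ℤₚ.≤-refl lo))
              (weaken sub (conv (λ (j , α) → cong (λ x → ℤ.- (+ x)) (ℕₚ.+-identityʳ (weight i j α)))
                                ℤₚ.≤-refl hi)))
      refute-rows zero (_ ∷ _ ∷ _) (s≤s ()) _ _ _ _
      refute-rows (suc k) is {path} {v} len≤ len≤m lo hi v≢ =
        refutable-mono (ℕₚ.≤-reflexive (sym (ℕₚ.*-assoc (suc B) (suc B ^ k) (assignmentLeaves d))))
          -- The range `0, …, B` serves every sublist of at most `m` rows; keeping it fixed makes
          -- the total cost a power of `suc B`.
          (refutable-value B _ (form (rowForm ys)) (form-≥0 (rowForm ys))
            (rowForm-≤ ys (length-bound ys ys≤m)) step)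
        where
        ys = take (2 ^ k) is
        zs = drop (2 ^ k) is
        ys≤ : length ys ≤ 2 ^ k
        ys≤ = ℕₚ.≤-trans (ℕₚ.≤-reflexive (length-take (2 ^ k) is)) (ℕₚ.m⊓n≤m (2 ^ k) (length is))
        ys≤m : length ys ≤ m
        ys≤m = ℕₚ.≤-trans (ℕₚ.≤-reflexive (length-take (2 ^ k) is))
                 (ℕₚ.≤-trans (ℕₚ.m⊓n≤n (2 ^ k) (length is)) len≤m)
        zs≤ : length zs ≤ 2 ^ k
        zs≤ = ℕₚ.≤-trans (ℕₚ.≤-reflexive (length-drop (2 ^ k) is))
                (ℕₚ.m≤n+o⇒m∸n≤o (length is) (2 ^ k)
                  (subst (λ l → length is ≤ 2 ^ k + l) (ℕₚ.+-identityʳ (2 ^ k)) len≤))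
        zs≤m : length zs ≤ m
        zs≤m = ℕₚ.≤-trans (ℕₚ.≤-reflexive (length-drop (2 ^ k) is))
                 (ℕₚ.≤-trans (ℕₚ.m∸n≤m (length is) (2 ^ k)) len≤m)
        split : ∀ (f : Fin m → ℕ) → + sumℕ is f ≡ + sumℕ ys f ℤ.+ + sumℕ zs f
        split f = trans (cong (λ l → + sumℕ l f) (sym (take++drop≡id (2 ^ k) is)))
                        (cong +_ (sumℕ-++ ys zs f))
        step : ∀ l {path′} → path ⊆ path′ → path′ ⊢ form (rowForm ys) ≥ + l →
               path′ ⊢ (λ w → ℤ.- form (rowForm ys) w) ≥ ℤ.- (+ l) →
               Refutable path′ (suc B ^ k * assignmentLeaves d)
        step l sub lo′ hi′ with (+ p) ∣ℤ.∣? (+ l ℤ.- + rowSum ys)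
        ... | no  l≢ = refute-rows k ys ys≤ ys≤m lo′ hi′ l≢
        -- If `l` is right for `ys`, then `v - l` must be wrong for `zs`, as otherwise `v` would be
        -- right. Adding opposite bounds pins the form of `zs` to `v - l`.
        ... | yes l≡ = refute-rows k zs {v = v ℤ.- + l} zs≤ zs≤m
            (conv (λ (j , α) → trans (cong (λ x → x ℤ.- + rowForm ys j α) (split (λ i → weight i j α)))
                                     (cancel (+ rowForm ys j α) (+ rowForm zs j α)))
                  ℤₚ.≤-refl (add (weaken sub lo) hi′))
            (conv (λ (j , α) → trans (cong (λ x → (ℤ.- x) ℤ.+ + rowForm ys j α) (split (λ i → weight i j α)))
                                     (cancel′ (+ rowForm ys j α) (+ rowForm zs j α)))
                  (ℤₚ.≤-reflexive (cancel″ v (+ l))) (add (weaken sub hi) lo′))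
            (λ v-l≡ → v≢ (subst (+ p ∣ℤ.∣_)
              (trans (regroup v (+ l) (+ rowSum ys) (+ rowSum zs)) (cong (λ x → v ℤ.- x) (sym (split target))))
              (∣ℤ.∣m∣n⇒∣m+n l≡ v-l≡)))
          where
          cancel : ∀ x y → (x ℤ.+ y) ℤ.- x ≡ y
          cancel = solve-∀
          cancel′ : ∀ x y → (ℤ.- (x ℤ.+ y)) ℤ.+ x ≡ ℤ.- y
          cancel′ = solve-∀
          cancel″ : ∀ x y → ℤ.- (x ℤ.- y) ≡ (ℤ.- x) ℤ.+ y
          cancel″ = solve-∀
          regroup : ∀ v l y z → (l ℤ.- y) ℤ.+ ((v ℤ.- l) ℤ.- z) ≡ v ℤ.- (y ℤ.+ z)
          regroup = solve-∀

      -- The sum of all rows has coefficients divisible by p, so branching on its p-th part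
      -- determines it, with a value that is 0 mod p, whereas the targets do not sum to 0.
      refute : ∀ k → m ≤ 2 ^ k → Refutable [] (suc B * (suc B ^ k * assignmentLeaves d) + 1)
      -- The left branch of this query supplies the upper bound `B` on `part`. The right branch
      -- closes at once, because `part ≥ B + 1` makes the sum of all rows at least `p * (B + 1)`,
      -- which exceeds `B`.
      refute k m≤ = query (form part) (+ suc B)
        (refutable-value B _ (form part) (form-≥0 part) (hyp (here refl))
          (λ l sub lo hi → refute-rows k (allFin m) {v = + (l * p)} (subst (_≤ 2 ^ k) (sym length-all) m≤)
            (ℕₚ.≤-reflexive length-all)
            (conv total (ℤₚ.≤-reflexive (pos-*-comm l)) (scale p lo))
            (conv (λ v → trans (negate (+ p) (form part v)) (cong ℤ.-_ (total v)))
                  (ℤₚ.≤-reflexive (trans (cong ℤ.-_ (pos-*-comm l)) (sym (negate (+ p) (+ l)))))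
                  (scale p hi))
            (λ lp≡ → targets (∣ℤ.∣⇒∣ᵤ (subst (+ p ∣ℤ.∣_) (difference (+ (l * p)) (+ rowSum (allFin m)))
              (∣ℤ.∣m∣n⇒∣m-n (∣ℤ.divides (+ l) (ℤₚ.pos-* l p)) lp≡))))))
        (refutable-leaf (clash (conv total ℤₚ.≤-refl (scale p (hyp (here refl))))
          (rowForm-≤ (allFin m) (length-bound (allFin m) (ℕₚ.≤-reflexive length-all)))
          (ℤₚ.<-≤-trans (ℤ.+<+ (ℕₚ.n<1+n B)) (ℤₚ.≤-trans (ℤ.+≤+ (ℕₚ.m≤n*m (suc B) p))
            (ℤₚ.≤-reflexive (ℤₚ.pos-* p (suc B)))))))
        where
        instance
          p≢0 : NonZero p
          p≢0 = ℕ.>-nonZero 0<p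
        length-all : length (allFin m) ≡ m
        length-all = length-tabulate id
        part : Coeffs
        part j α = ∣.quotient (columns j α)
        pos-*-comm : ∀ l → + (l * p) ≡ + p ℤ.* + l
        pos-*-comm l = trans (cong +_ (ℕₚ.*-comm l p)) (ℤₚ.pos-* p l)
        total : ∀ v → + p ℤ.* form part v ≡ form (rowForm (allFin m)) v
        total (j , α) = trans (sym (pos-*-comm (part j α))) (cong +_ (sym (_∣_.equality (columns j α))))
        negate : ∀ x y → x ℤ.* (ℤ.- y) ≡ ℤ.- (x ℤ.* y)
        negate = solve-∀
        difference : ∀ x y → x ℤ.- (x ℤ.- y) ≡ y
        difference = solve-∀

-- Size estimates and assembly.

-- The induction follows the well-founded recursion that computes the logarithm, hence the explicit
-- accessibility argument; each step uses `n ≤ 2⌈n/2⌉`.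
n≤2^⌈log₂n⌉ : ∀ n → n ≤ 2 ^ ⌈log₂ n ⌉
n≤2^⌈log₂n⌉ n = go n (<-wellFounded n)
  where
  n≤⌈n/2⌉+⌈n/2⌉ : ∀ n → n ≤ ℕ.⌈ n /2⌉ + ℕ.⌈ n /2⌉
  n≤⌈n/2⌉+⌈n/2⌉ n = ℕₚ.≤-trans (ℕₚ.≤-reflexive (sym (ℕₚ.⌊n/2⌋+⌈n/2⌉≡n n)))
                               (ℕₚ.+-monoˡ-≤ ℕ.⌈ n /2⌉ (ℕₚ.⌊n/2⌋≤⌈n/2⌉ n))
  go : ∀ n (rec : Acc ℕ._<_ n) → n ≤ 2 ^ ⌈log2⌉ n rec
  go 0             _        = z≤n
  go 1             _        = ℕₚ.≤-refl
  go (suc (suc n)) (acc rs) = ℕₚ.≤-trans (n≤⌈n/2⌉+⌈n/2⌉ (suc (suc n)))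
    (ℕₚ.≤-trans (ℕₚ.+-mono-≤ half half)
      (ℕₚ.≤-reflexive (cong (λ x → 2 ^ l + x) (sym (ℕₚ.+-identityʳ (2 ^ l))))))
    where
    l = ⌈log2⌉ (suc ℕ.⌈ n /2⌉) (rs (ℕₚ.⌈n/2⌉<n n))
    half : suc ℕ.⌈ n /2⌉ ≤ 2 ^ l
    half = go (suc ℕ.⌈ n /2⌉) (rs (ℕₚ.⌈n/2⌉<n n))

2≤order : ∀ {q} → FiniteField q → 2 ≤ q
2≤order {zero} 𝔽 with () ← FiniteField.0# 𝔽
2≤order {suc zero} 𝔽 = contradiction (unique _ _) (FiniteField.0≢1 𝔽)
  where
  unique : ∀ (x y : Fin 1) → x ≡ y
  unique Fin.zero Fin.zero = refl
2≤order {suc (suc _)} 𝔽 = s≤s (s≤s z≤n)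

module _ {q n m : ℕ} (𝔽 : FiniteField q) (F : Fin m → Equation q n) where
  open Refuting 𝔽 F
  open FiniteField 𝔽 using (0#)
  open FieldFacts 𝔽 using (certificate; module Certificate)

  -- The extra `suc` carries the induction: `2 + q * a ≤ q * suc a` because `q ≥ 2`.
  assignmentLeaves-≤ : ∀ d → suc (assignmentLeaves d) ≤ 2 * q ^ d
  assignmentLeaves-≤ zero    = ℕₚ.≤-refl
  assignmentLeaves-≤ (suc d) = begin
    2 + q * a           ≤⟨ ℕₚ.+-monoˡ-≤ (q * a) (2≤order 𝔽) ⟩
    q + q * a           ≡⟨ ℕₚ.*-suc q a ⟨
    q * suc a           ≤⟨ ℕₚ.*-monoʳ-≤ q (assignmentLeaves-≤ d) ⟩
    q * (2 * q ^ d)     ≡⟨ swap q (q ^ d) ⟩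
    2 * (q * q ^ d)     ∎
    where
    open ℕₚ.≤-Reasoning
    a = assignmentLeaves d
    swap : ∀ x y → x * (2 * y) ≡ 2 * (x * y)
    swap = ℕSolver.solve-∀

  -- For `d = 0` the size bound is 0, so a bare leaf must do. All supports are empty, and a violated
  -- equation `0 = b_i` contributes the empty clause.
  refutation-width-0 : Width≤ 𝔽 0 F → Unsatisfiable 𝔽 F → SPRefutation (Input 𝔽 F) leaf
  refutation-width-0 width unsat with any? (λ i → ¬? (dot 𝔽 (coeffs (F i)) (λ _ → 0#) ≟ rhs (F i)))
  ... | no all-sat = contradiction
          ((λ _ → 0#) , λ i → decidable-stable (_ ≟ _) (λ ¬sat → all-sat (i , ¬sat))) unsat
  ... | yes (i , ¬sat) = absurd⇒leaf (equation-absurd (λ _ → 0#) (support 𝔽 (coeffs (F i)))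
          (λ j∈ → contradiction j∈ (empty (support 𝔽 (coeffs (F i))) (width i)))
          (input (clause _ (equation i (λ _ → 0#) ¬sat))))
    where
    empty : ∀ {A : Set} {x : A} xs → length xs ≤ 0 → x ∉ xs
    empty [] _ ()

  module _ (unsat : Unsatisfiable 𝔽 F) where
    open Certificate (certificate F unsat) using (p; p≤q)

    -- With `A = m * q * d`, the branching factor is at most `A ^ 3` and occurs `1 + k` times, while
    -- the factor 2 from the leaves is absorbed by `A ^ (1 + k)`. This gives the constant 4; nonzero
    -- `m * d` ensures `A ≥ q ≥ 2`.
    size-bound : ∀ k d .{{_ : NonZero (m * d)}} →
      suc (m * (d * (q * p))) * (suc (m * (d * (q * p))) ^ k * assignmentLeaves d)
        ≤ (m * q * d) ^ (4 * (1 + k)) * q ^ d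
    size-bound k d = begin
      b * (b ^ k * assignmentLeaves d)  ≡⟨ ℕₚ.*-assoc b (b ^ k) (assignmentLeaves d) ⟨
      b ^ (1 + k) * assignmentLeaves d  ≤⟨ ℕₚ.*-mono-≤ (ℕₚ.^-monoˡ-≤ (1 + k) b≤A³) leaves≤ ⟩
      (A ^ 3) ^ (1 + k) * (2 * q ^ d)   ≤⟨ ℕₚ.*-monoʳ-≤ ((A ^ 3) ^ (1 + k)) (ℕₚ.*-monoˡ-≤ (q ^ d) 2≤A^) ⟩
      (A ^ 3) ^ (1 + k) * (A ^ (1 + k) * q ^ d)
                                        ≡⟨ cong (_* (A ^ (1 + k) * q ^ d)) (ℕₚ.^-*-assoc A 3 (1 + k)) ⟩
      A ^ (3 * (1 + k)) * (A ^ (1 + k) * q ^ d)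
                                        ≡⟨ ℕₚ.*-assoc (A ^ (3 * (1 + k))) (A ^ (1 + k)) (q ^ d) ⟨
      A ^ (3 * (1 + k)) * A ^ (1 + k) * q ^ d
                                        ≡⟨ cong (_* q ^ d) (ℕₚ.^-distribˡ-+-* A (3 * (1 + k)) (1 + k)) ⟨
      A ^ (3 * (1 + k) + (1 + k)) * q ^ d
                                        ≡⟨ cong (λ e → A ^ e * q ^ d) (ℕₚ.+-comm (3 * (1 + k)) (1 + k)) ⟩
      A ^ (4 * (1 + k)) * q ^ d         ∎
      where
      open ℕₚ.≤-Reasoning
      A = m * q * d
      b = suc (m * (d * (q * p)))
      leaves≤ : assignmentLeaves d ≤ 2 * q ^ d
      leaves≤ = ℕₚ.<⇒≤ (assignmentLeaves-≤ d)
      rearrange : ∀ m q d → m * d * q ≡ m * q * d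
      rearrange = ℕSolver.solve-∀
      rearrange′ : ∀ m q d p → m * (d * (q * p)) ≡ (m * q * d) * p
      rearrange′ = ℕSolver.solve-∀
      q≤A : q ≤ A
      q≤A = ℕₚ.≤-trans (ℕₚ.m≤n*m q (m * d)) (ℕₚ.≤-reflexive (rearrange m q d))
      2≤A : 2 ≤ A
      2≤A = ℕₚ.≤-trans (2≤order 𝔽) q≤A
      instance
        A≢0 : NonZero A
        A≢0 = ℕ.>-nonZero (ℕₚ.≤-trans (s≤s z≤n) 2≤A)
      2≤A^ : 2 ≤ A ^ (1 + k)
      2≤A^ = ℕₚ.≤-trans 2≤A (ℕₚ.m≤m*n A (A ^ k) {{ℕₚ.m^n≢0 A k}})
      1≤A² : 1 ≤ A * A
      1≤A² = ℕₚ.*-mono-≤ {1} {A} {1} {A} (ℕₚ.≤-trans (s≤s z≤n) 2≤A) (ℕₚ.≤-trans (s≤s z≤n) 2≤A)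
      double : ∀ x → x + x ≡ 2 * x
      double = ℕSolver.solve-∀
      b≤A³ : b ≤ A ^ 3
      b≤A³ = begin
        1 + m * (d * (q * p))   ≡⟨ cong suc (rearrange′ m q d p) ⟩
        1 + A * p               ≤⟨ s≤s (ℕₚ.*-monoʳ-≤ A (ℕₚ.≤-trans p≤q q≤A)) ⟩
        1 + A * A               ≤⟨ ℕₚ.+-monoˡ-≤ (A * A) 1≤A² ⟩
        A * A + A * A           ≡⟨ double (A * A) ⟩
        2 * (A * A)             ≤⟨ ℕₚ.*-monoˡ-≤ (A * A) 2≤A ⟩
        A * (A * A)             ≡⟨ cong (λ x → A * (A * x)) (ℕₚ.*-identityʳ A) ⟨
        A ^ 3                   ∎

theorem4p1 : Σ ℕ λ c →
    ∀ {q : ℕ} (𝔽 : FiniteField q) (n m d : ℕ) (F : Fin m → Equation q n) →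
    Width≤ 𝔽 d F → Unsatisfiable 𝔽 F →
    Σ (SPTree (BVar 𝔽 n)) λ T →
    SPRefutation (Input 𝔽 F) T
    × size T ≤ (m * q * d) ^ (c * (1 + ⌈log₂ m ⌉)) * q ^ d
theorem4p1 = 4 , λ where
  𝔽 n zero d F width unsat → contradiction ((λ _ → FiniteField.0# 𝔽) , λ ()) unsat
  𝔽 n (suc m) zero F width unsat → leaf , refutation-width-0 𝔽 F width unsat , z≤n
  𝔽 n (suc m) (suc d) F width unsat →
    let open FieldFacts 𝔽 using (certificate)
        k = ⌈log₂ suc m ⌉
        T , refutes , leaves≤ = Refuting.refute 𝔽 F (certificate F unsat) width _ ℕₚ.≤-refl k
                                  (n≤2^⌈log₂n⌉ (suc m))
    -- The one leaf beyond the product in `refute` is offset by passing from leaves to queries.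
    in T , refutes , ℕₚ.≤-trans (ℕₚ.≤-pred (ℕₚ.≤-trans leaves≤ (ℕₚ.≤-reflexive (ℕₚ.+-comm _ 1))))
                                (size-bound 𝔽 F unsat k (suc d))
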